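{- Let $M$ and $N$ be nonisomorphic loopless matroids with $\mathcal{G}(M)=\mathcal{G}(N)$. Then for every integer $m\geq 1$, the free $m$-cones $Q_m(M)$ and $Q_m(N)$ have the same $\mathcal{G}$-invariant and different configurations.
   Context: $\mathcal{G}$-invariant: for a rank-$k$ matroid $M$ on an $n$-element set $E$ and a bijection $\pi:[n]\to E$, the rank sequence is $\underline{r}(\pi)=r_1r_2\cdots r_n$ with $r_i=r(\{\pi(1),\dots,\pi(i)\})-r(\{\pi(1),\dots,\pi(i-1)\})$ (a sequence of $k$ ones and $n-k$ zeros). Then $\mathcal{G}(M)=\sum_\pi[\underline{r}(\pi)]$, a formal linear combination (over a field of characteristic zero) of symbols $[\underline{s}]$ indexed by such 0/1 sequences, the sum over all bijections $\pi$. Configuration: a set $X$ is cyclic if $M|X$ has no coloops; the cyclic flats of $M$ form a lattice $\mathcal{Z}(M)$ under inclusion; the configuration of $M$ is the triple $(L,s,\rho)$ where $L$ is an abstract lattice isomorphic via some $\phi:L\to\mathcal{Z}(M)$ with $s(x)=|\phi(x)|$ and $\rho(x)=r(\phi(x))$; two matroids have the same configuration if these triples are isomorphic (lattice isomorphism preserving $s$ and $\rho$). Free $m$-cone: let $M=(E,r)$ be loopless and $m\geq1$. For each $e\in E$ let $T_e$ be a set of $m$ new elements (pairwise disjoint, disjoint from $E$), $T=\bigcup_e T_e$, and $a$ a further new element (the tip); $E(Q)=E\cup T\cup\{a\}$. For $S\subseteq E$ let $q(S)=S\cup\{a\}\cup\bigcup_{e\in S}T_e$. The free $m$-cone $Q_m(M)$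 is the unique matroid on $E(Q)$ whose cyclic flats are exactly the sets in $\mathcal{Z}(M)\cup\{q(F):F\text{ a nonempty flat of }M\}$, with rank $r(Z)$ on $Z\in\mathcal{Z}(M)$ and rank $r(F)+1$ on $q(F)$. -}

module Defs where

open import Data.Nat using (ℕ; zero; suc; _+_; _*_; _∸_; _≤_; _<_)
open import Data.Nat.Properties using () renaming (_≟_ to _≟ℕ_)
open import Data.Bool using (Bool; true; false; not; _∧_; T)
open import Data.Fin using (Fin; zero; suc; splitAt; remQuot) renaming (_≟_ to _≟F_)
open import Data.Fin.Subset using (Subset; _∈_; _∉_; _⊆_; _∪_; _∩_; _-_; ⁅_⁆; ∣_∣; ⊥)
open import Data.Vec using (Vec; []; _∷_; tabulate; lookup)
open import Data.List using (List; []; _∷_; [_]; map; concatMap; allFin; filterᵇ; length)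
open import Data.Bool.ListAction using (any)
open import Data.List.Properties using (≡-dec)
open import Data.Sum using (_⊎_; inj₁; inj₂)
open import Data.Product using (Σ; ∃; _×_; _,_; proj₁; proj₂)
open import Relation.Nullary using (¬_; does)
open import Relation.Binary.PropositionalEquality using (_≡_; _≢_)
open import Function.Bundles using (_↔_; Inverse)

record Matroid (k : ℕ) : Set where
  field
    rank    : Subset k → ℕ
    rank-≤  : ∀ X → rank X ≤ ∣ X ∣
    rank-mono : ∀ X Y → X ⊆ Y → rank X ≤ rank Y
    rank-submod : ∀ X Y → rank (X ∪ Y) + rank (X ∩ Y) ≤ rank X + rank Y
open Matroid public

module _ {k : ℕ} (M : Matroid k) where

  Loopless : Set
  Loopless = ∀ (e : Fin k) → rank M ⁅ e ⁆ ≡ 1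

  -- X is cyclic: M|X has no coloops, i.e. deleting any e ∈ X keeps rank
  IsCyclic : Subset k → Set
  IsCyclic X = ∀ e → e ∈ X → rank M (X - e) ≡ rank M X

  IsFlat : Subset k → Set
  IsFlat X = ∀ e → e ∉ X → rank M X < rank M (X ∪ ⁅ e ⁆)

  IsCyclicFlat : Subset k → Set
  IsCyclicFlat X = IsCyclic X × IsFlat X

Isomorphic : ∀ {k k'} → Matroid k → Matroid k' → Set
Isomorphic {k} {k'} M N =
  Σ (Fin k ↔ Fin k') λ σ →
    ∀ (Y : Subset k') → rank N Y ≡ rank M (tabulate λ x → lookup Y (Inverse.to σ x))

-- G-invariant.  A bijection π : [k] → E is represented by the vector
-- (π(1),…,π(k)) of pairwise distinct elements of Fin k.

vecs : (k l : ℕ) → List (Vec (Fin k) l)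
vecs k zero    = [ [] ]
vecs k (suc l) = concatMap (λ x → map (x ∷_) (vecs k l)) (allFin k)

distinct : ∀ {k l} → Vec (Fin k) l → Bool
distinct []       = true
distinct (x ∷ xs) = not (any (λ y → does (x ≟F y)) (toList xs)) ∧ distinct xs
  where open import Data.Vec using (toList)

rankSeqFrom : ∀ {k l} → Matroid k → Subset k → Vec (Fin k) l → List ℕ
rankSeqFrom M S []       = []
rankSeqFrom M S (x ∷ xs) =
  (rank M (S ∪ ⁅ x ⁆) ∸ rank M S) ∷ rankSeqFrom M (S ∪ ⁅ x ⁆) xs

rankSeq : ∀ {k} → Matroid k → Vec (Fin k) k → List ℕ
rankSeq M π = rankSeqFrom M ⊥ π

Gcoeff : ∀ {k} → Matroid k → List ℕ → ℕ
Gcoeff {k} M s =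
  length (filterᵇ (λ π → distinct π ∧ does (≡-dec _≟ℕ_ (rankSeq M π) s)) (vecs k k))

-- G(M) = G(N) (formal combinations over a field of char. 0: equal iff all
-- coefficients agree)
SameG : ∀ {k k'} → Matroid k → Matroid k' → Set
SameG M N = ∀ (s : List ℕ) → Gcoeff M s ≡ Gcoeff N s

-- Configuration.  Two matroids have the same configuration iff there is
-- a lattice (= order) isomorphism between their lattices of cyclic flats
-- preserving size and rank.

SameConfig : ∀ {k k'} → Matroid k → Matroid k' → Set
SameConfig {k} {k'} M N =
  Σ (Subset k → Subset k') λ φ →
    (∀ X → IsCyclicFlat M X → IsCyclicFlat N (φ X))
  × (∀ Y → IsCyclicFlat N Y → ∃ λ X → IsCyclicFlat M X × φ X ≡ Y)
  × (∀ X Y → IsCyclicFlat M X → IsCyclicFlat M Y →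
       (X ⊆ Y → φ X ⊆ φ Y) × (φ X ⊆ φ Y → X ⊆ Y))                 -- order iso (hence injective)
  × (∀ X → IsCyclicFlat M X → ∣ φ X ∣ ≡ ∣ X ∣)
  × (∀ X → IsCyclicFlat M X → rank N (φ X) ≡ rank M X)

_⇔_ : Set → Set → Set
A ⇔ B = (A → B) × (B → A)

-- Free m-cone.  Ground set Fin (suc (n + n * m)):
--   zero              ↦ the tip a
--   suc x, x ∈ first n ↦ the element e ∈ E = Fin n
--   suc x, x in last n*m, remQuot ↦ (e , j) : the j-th element of T_e

data Kind (n m : ℕ) : Set where
  tip  : Kind n m
  base : Fin n → Kind n m
  tee  : Fin n → Fin m → Kind n m

decode : ∀ {n} m → Fin (suc (n + n * m)) → Kind n m
decode {n} m zero = tip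
decode {n} m (suc x) with splitAt n x
... | inj₁ e = base e
... | inj₂ t = tee (proj₁ (remQuot {n} m t)) (proj₂ (remQuot {n} m t))

embE : ∀ {n} m → Subset n → Subset (suc (n + n * m))
embE m S = tabulate λ x → f (decode m x)
  where
    f : _ → Bool
    f tip       = false
    f (base e)  = lookup S e
    f (tee e j) = false

qSet : ∀ {n} m → Subset n → Subset (suc (n + n * m))
qSet m S = tabulate λ x → f (decode m x)
  where
    f : _ → Bool
    f tip       = true
    f (base e)  = lookup S e
    f (tee e j) = lookup S e

IsFreeCone : ∀ {n} → Matroid n → (m : ℕ) → Matroid (suc (n + n * m)) → Set
IsFreeCone {n} M m Q =
    (∀ X → IsCyclicFlat Q X ⇔
       ((∃ λ Z → IsCyclicFlat M Z × X ≡ embE m Z)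
        ⊎ (∃ λ F → IsFlat M F × (∃ λ e → e ∈ F) × X ≡ qSet m F)))
  × (∀ Z → IsCyclicFlat M Z → rank Q (embE m Z) ≡ rank M Z)
  × (∀ F → IsFlat M F → (∃ λ e → e ∈ F) → rank Q (qSet m F) ≡ suc (rank M F))

{-# OPTIONS --safe #-}
-- For X ⊆ E(Q) let X_E = X ∩ E, and let supp X be the set of e ∈ E such that X meets {e} ∪ T_e. Since the
-- rank of X is the minimum of r(Z) + |X ∖ Z| over cyclic flats Z, one gets
--   r_Q(X) = min (r(X_E) + |X ∖ E| , 1 + r(supp X)).
--
-- G-invariant. Average over the action of Sym(E) on E(Q): it suffices that for each fixed permutation π of
-- E(Q) with prefixes X_i, the number of σ ∈ Sym(E) for which σπ has a given rank sequence depends only on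
-- G(M). The first term of the minimum is at least r(supp X), and equality at X_i implies equality at every
-- earlier prefix; so r_Q(X_i) is r(supp X_i) up to some time and 1 + r(supp X_i) afterwards. If equality
-- holds at time t, the ranks r(supp X_i) with i ≤ t can be read off from those of (X_i)_E, and
-- (X_0)_E ⊆ … ⊆ (X_t)_E ⊆ supp X_t ⊆ supp X_{t+1} ⊆ … is a chain, along which the distribution of the ranks
-- is determined by G(M). Differences over t give the distribution of the rank sequences of Q.
--
-- Configuration. Let φ be an isomorphism of configurations and q(F) the cone over a rank-one flat F of M.
-- Call F blue if φ(q(F)) = q(G) for a rank-one flat G of N, and red if φ(q(F)) is a rank-two cyclic flat Z
-- of N. Without red flats, φ yields an isomorphism of the lattices of flats preserving sizes and ranks, so
-- M ≅ N. Not all F are red, because joins of cyclic flats of N never contain the tip. Considering the cone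
-- over the join of two points, every blue G lies in every red Z. If there is only one blue G then it is a
-- singleton and the red lines Z all meet in G; as |Z| = 1 + (m+1)|F| they do not fit into E(N). If there are
-- two blue flats, then both matroids have rank two and there is only one red flat on either side; those two
-- have the same size and can be matched with each other, so again M ≅ N.
module Submission where

open import Defs
open import Data.Nat using (ℕ; zero; suc; _+_; _*_; _∸_; _≤_; _<_; z≤n; s≤s; _⊓_; _≤ᵇ_; NonZero; >-nonZero)
open import Data.Nat.Properties
open import Data.Bool using (Bool; true; false; T; not; _∧_; if_then_else_)
open import Data.Fin using (Fin; zero; suc; splitAt; combine; _↑ˡ_; _↑ʳ_; toℕ; fromℕ<; inject≤)
open import Data.Fin.Properties using (any?; all?; ¬∀⟶∃¬; splitAt-↑ˡ; splitAt-↑ʳ; splitAt⁻¹-↑ˡ; splitAt⁻¹-↑ʳ; remQuot-combine; combine-remQuot; toℕ-injective; toℕ-inject≤; toℕ-fromℕ<; toℕ<n)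
open import Data.Fin.Subset using (Subset; _∈_; _∉_; _⊆_; _∪_; _-_; ⁅_⁆; ∣_∣; ⊥; ⊤)
open import Data.Fin.Subset.Properties using (_∈?_; ∉⊥; x∈⁅x⁆; x∈⁅y⁆⇒x≡y; ∣⁅x⁆∣≡1; ∣⊥∣≡0; ⊆-antisym; x∈p∪q⁻; x∈p∪q⁺; x∈p∩q⁺; p⊆p∪q; q⊆p∪q; x∈p∧x≢y⇒x∈p-y; p─q⊆p; x∈p⇒∣p-x∣<∣p∣; ∪-assoc; ∪-identityʳ; ∪-identityˡ; ∪-comm; ∈⊤; p⊆q⇒∣p∣≤∣q∣)
open import Data.Vec using ([]; _∷_; tabulate; lookup; here; there; Vec; toList)
open import Data.Vec.Properties using (lookup∘tabulate; []=⇒lookup; lookup⇒[]=; tabulate-cong; tabulate∘lookup)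
open import Data.List using (List; []; _∷_; map; length; take; filterᵇ; concatMap; allFin; cartesianProductWith; mapMaybe; [_]; drop; _++_)
open import Data.List.Properties using (length-map; ≡-dec; length-tabulate; length-mapMaybe; mapMaybe-map; mapMaybe-cong; map-mapMaybe; take++drop≡id; mapMaybe-++; map-++; filter-++; length-++; take-map; ++-assoc; ++-identityʳ)
open import Data.List.Membership.Propositional using () renaming (_∈_ to _∈ₗ_; _∉_ to _∉ₗ_)
open import Data.List.Membership.Propositional.Properties using (∈-map⁺; ∈-map⁻; ∈-∃++; ∈-++⁺ˡ; ∈-++⁺ʳ; ∈-++⁻; ∈-allFin; ∈-filter⁺; ∈-filter⁻; ∈-cartesianProductWith⁺; ∈-length; ∈-lookup; ∈-cartesianProductWith⁻)
open import Data.List.Relation.Unary.Any using (here; there; index)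
open import Data.List.Relation.Unary.All as All using (All; []; _∷_)
open import Data.List.Relation.Unary.AllPairs using ([]; _∷_)
open import Data.List.Relation.Unary.Unique.Propositional using (Unique)
open import Data.List.Relation.Binary.Permutation.Propositional using (_↭_; ↭-refl; ↭-trans; prep; ↭-reflexive; ↭-sym)
open import Data.List.Relation.Binary.Permutation.Propositional.Properties using (shift; ↭-length; ∈-resp-↭; filter-↭)
open import Data.Sum using (_⊎_; inj₁; inj₂; [_,_]′)
open import Data.Product using (∃; _×_; _,_; proj₁; proj₂)
open import Data.Empty using (⊥-elim) renaming (⊥ to Absurd)
open import Function using (_∘_; id)
open import Relation.Nullary using (¬_; Dec; yes; no; does)
open import Relation.Nullary.Decidable using (_→-dec_; ¬?; dec-true; dec-false; _×-dec_; decidable-stable)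
open import Relation.Binary.PropositionalEquality hiding ([_])
open import Algebra.Properties.CommutativeSemigroup +-commutativeSemigroup using (x∙yz≈y∙xz)
open import Data.Bool.ListAction using (any)
open import Data.Nat.ListAction using (sum)
open import Data.Bool.Properties using (T?; T-≡)
open import Function.Bundles using (Equivalence; Inverse; mk↔ₛ′)
open import Relation.Binary using (DecidableEquality)
open import Data.Maybe using (Maybe; just; nothing)
open import Data.Nat.Tactic.RingSolver using (solve-∀)
open import Data.List.Relation.Unary.Any.Properties using (lookup-index)
import Data.List as List
import Data.List.Relation.Unary.Unique.Propositional.Properties as Uniq
import Data.Vec as Vec
import Data.Vec.Properties as Vecₚ
import Data.Vec.Membership.Propositional.Properties as VecMemₚ
import Data.List.Membership.DecPropositional as DecMembership
import Data.Sum as Sum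
import Data.Maybe as Maybe

private
  variable
    ν : ℕ

-- Finite lists and subsets of Fin ν

-- Entries of `xs` are pulled out of `ys` one at a time. Distinctness keeps the later ones in what
-- remains of `ys`, which may have repetitions.
unique-⊆⇒↭ : ∀ {A : Set} {xs ys : List A} → Unique xs → (∀ {x} → x ∈ₗ xs → x ∈ₗ ys) →
              ∃ λ zs → ys ↭ xs ++ zs
unique-⊆⇒↭ {ys = ys} [] _ = ys , ↭-refl
unique-⊆⇒↭ {xs = x ∷ xs} (x∉xs ∷ u) sub with ∈-∃++ (sub (here refl))
... | as , bs , refl with unique-⊆⇒↭ {xs = xs} {as ++ bs} u sub′
  where
  sub′ : ∀ {y} → y ∈ₗ xs → y ∈ₗ as ++ bs
  sub′ y∈ with ∈-++⁻ as (sub (there y∈))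
  ... | inj₁ p = ∈-++⁺ˡ p
  ... | inj₂ (here y≡x) = ⊥-elim (All.lookup x∉xs y∈ (sym y≡x))
  ... | inj₂ (there p) = ∈-++⁺ʳ as p
... | zs , p = zs , ↭-trans (shift x as bs) (prep x p)

unique-⊆⇒length≤ : ∀ {A : Set} {xs ys : List A} → Unique xs → (∀ {x} → x ∈ₗ xs → x ∈ₗ ys) →
                    length xs ≤ length ys
unique-⊆⇒length≤ {xs = xs} u sub with unique-⊆⇒↭ u sub
... | zs , p rewrite ↭-length p | length-++ xs {zs} = m≤m+n (length xs) (length zs)

-- Pigeonhole: the length bound leaves no room for a remainder `zs`. Below this shows that an
-- injective self-map permutes a finite list.
unique-⊆-length⇒↭ : ∀ {A : Set} {xs ys : List A} → Unique xs → (∀ {x} → x ∈ₗ xs → x ∈ₗ ys) →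
                     length ys ≤ length xs → ys ↭ xs
unique-⊆-length⇒↭ {xs = xs} u sub le with unique-⊆⇒↭ u sub
... | [] , p = ↭-trans p (↭-reflexive (++-identityʳ xs))
... | z ∷ zs , p = ⊥-elim (<⇒≱ (begin-strict
    length xs                      <⟨ m<m+n (length xs) (s≤s z≤n) ⟩
    length xs + suc (length zs)    ≡⟨ sym (length-++ xs) ⟩
    length (xs ++ z ∷ zs)     ≡⟨ sym (↭-length p) ⟩
    _ ∎) le)
  where open ≤-Reasoning

∈-tabulate⁺ : ∀ {f : Fin ν → Bool} {x} → f x ≡ true → x ∈ tabulate f
∈-tabulate⁺ {f = f} {x} eq = lookup⇒[]= x _ (trans (lookup∘tabulate f x) eq)

∈-tabulate⁻ : ∀ {f : Fin ν → Bool} {x} → x ∈ tabulate f → f x ≡ true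
∈-tabulate⁻ {f = f} {x} p = trans (sym (lookup∘tabulate f x)) ([]=⇒lookup p)

does-true : ∀ {A : Set} (a? : Dec A) → does a? ≡ true → A
does-true (yes a) _ = a

setOf : List (Fin ν) → Subset ν
setOf []       = ⊥
setOf (x ∷ xs) = ⁅ x ⁆ ∪ setOf xs

∈-setOf⁺ : ∀ {x : Fin ν} {xs} → x ∈ₗ xs → x ∈ setOf xs
∈-setOf⁺ {xs = y ∷ ys} (here refl) = x∈p∪q⁺ (inj₁ (x∈⁅x⁆ y))
∈-setOf⁺ {xs = y ∷ ys} (there p)   = x∈p∪q⁺ (inj₂ (∈-setOf⁺ p))

∈-setOf⁻ : ∀ {x : Fin ν} xs → x ∈ setOf xs → x ∈ₗ xs
∈-setOf⁻ [] p = ⊥-elim (∉⊥ p)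
∈-setOf⁻ (y ∷ ys) p with x∈p∪q⁻ ⁅ y ⁆ (setOf ys) p
... | inj₁ q = here (x∈⁅y⁆⇒x≡y y q)
... | inj₂ q = there (∈-setOf⁻ ys q)

elements : Subset ν → List (Fin ν)
elements []          = []
elements (true  ∷ S) = zero ∷ map suc (elements S)
elements (false ∷ S) = map suc (elements S)

∈-elements⁺ : ∀ {S : Subset ν} {x} → x ∈ S → x ∈ₗ elements S
∈-elements⁺ {S = true  ∷ S} here      = here refl
∈-elements⁺ {S = true  ∷ S} (there p) = there (∈-map⁺ suc (∈-elements⁺ p))
∈-elements⁺ {S = false ∷ S} (there p) = ∈-map⁺ suc (∈-elements⁺ p)

∈-elements⁻ : ∀ {S : Subset ν} {x} → x ∈ₗ elements S → x ∈ S
∈-elements⁻ {S = true ∷ S} (here refl) = here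
∈-elements⁻ {S = true ∷ S} (there p) with ∈-map⁻ suc p
... | y , q , refl = there (∈-elements⁻ q)
∈-elements⁻ {S = false ∷ S} p with ∈-map⁻ suc p
... | y , q , refl = there (∈-elements⁻ q)

elements-unique : ∀ (S : Subset ν) → Unique (elements S)
elements-unique []          = []
elements-unique (true  ∷ S) =
  All.tabulate (λ p → λ { refl → case∈ (∈-map⁻ suc p) }) ∷ Uniq.map⁺ Data.Fin.Properties.suc-injective (elements-unique S)
  where
  case∈ : ¬ (∃ λ y → y ∈ₗ elements S × zero ≡ suc y)
  case∈ (_ , _ , ())
elements-unique (false ∷ S) = Uniq.map⁺ Data.Fin.Properties.suc-injective (elements-unique S)

length-elements : ∀ (S : Subset ν) → length (elements S) ≡ ∣ S ∣
length-elements []          = refl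
length-elements (true  ∷ S) = cong suc (trans (length-map suc (elements S)) (length-elements S))
length-elements (false ∷ S) = trans (length-map suc (elements S)) (length-elements S)

∣∣≡length : ∀ {S : Subset ν} {xs} → Unique xs → (∀ {x} → x ∈ₗ xs → x ∈ S) → (∀ {x} → x ∈ S → x ∈ₗ xs) →
            ∣ S ∣ ≡ length xs
∣∣≡length {S = S} u xs⊆S S⊆xs = trans (sym (length-elements S)) (≤-antisym
  (unique-⊆⇒length≤ (elements-unique S) (S⊆xs ∘ ∈-elements⁻))
  (unique-⊆⇒length≤ u (∈-elements⁺ ∘ xs⊆S)))

∪-lub : ∀ {X Y Z : Subset ν} → X ⊆ Z → Y ⊆ Z → X ∪ Y ⊆ Z
∪-lub {X = X} {Y} f g p = [ f , g ]′ (x∈p∪q⁻ X Y p)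

⁅⁆⊆ : ∀ {e : Fin ν} {X} → e ∈ X → ⁅ e ⁆ ⊆ X
⁅⁆⊆ {e = e} {X} e∈X p = subst (_∈ X) (sym (x∈⁅y⁆⇒x≡y e p)) e∈X

∪-mono : ∀ {X X′ Y Y′ : Subset ν} → X ⊆ X′ → Y ⊆ Y′ → X ∪ Y ⊆ X′ ∪ Y′
∪-mono {X′ = X′} {Y′ = Y′} f g = ∪-lub (p⊆p∪q Y′ ∘ f) (q⊆p∪q X′ Y′ ∘ g)

x∉p-x : ∀ {X : Subset ν} {e} → e ∉ X - e
x∉p-x {X = x ∷ X} {zero} ()
x∉p-x {X = x ∷ X} {suc e} (there p) = x∉p-x {X = X} p

∈-remove⁻ : ∀ {X : Subset ν} {e x} → x ∈ X - e → x ∈ X × x ≢ e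
∈-remove⁻ {X = X} {e} p = p─q⊆p X ⁅ e ⁆ p , λ { refl → x∉p-x {X = X} p }

⊆remove∪ : ∀ {X : Subset ν} {e} → X ⊆ (X - e) ∪ ⁅ e ⁆
⊆remove∪ {X = X} {e} {x} p with x Data.Fin.≟ e
... | yes refl = q⊆p∪q (X - e) ⁅ e ⁆ (x∈⁅x⁆ e)
... | no  ne   = p⊆p∪q ⁅ e ⁆ (x∈p∧x≢y⇒x∈p-y p ne)

∣remove∣ : ∀ {X : Subset ν} {e} → e ∈ X → ∣ X ∣ ≡ suc ∣ X - e ∣
∣remove∣ {X = X} {e} e∈X = trans
  (∣∣≡length {xs = e ∷ elements (X - e)}
    (All.tabulate (λ p → λ { refl → x∉p-x {X = X} (∈-elements⁻ p) }) ∷ elements-unique (X - e))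
    (λ { (here refl) → e∈X ; (there p) → proj₁ (∈-remove⁻ {X = X} (∈-elements⁻ p)) })
    to)
  (cong suc (length-elements (X - e)))
  where
  to : ∀ {x} → x ∈ X → x ∈ₗ e ∷ elements (X - e)
  to {x} p with x Data.Fin.≟ e
  ... | yes refl = here refl
  ... | no ne = there (∈-elements⁺ (x∈p∧x≢y⇒x∈p-y p ne))

-- Closure, flats and cyclic sets

module _ (M : Matroid ν) where

  Spans : Subset ν → Fin ν → Set
  Spans X e = rank M (X ∪ ⁅ e ⁆) ≡ rank M X

  rank-⊥ : rank M ⊥ ≡ 0
  rank-⊥ = n≤0⇒n≡0 (≤-trans (rank-≤ M ⊥) (≤-reflexive (∣⊥∣≡0 ν)))

  rank-⁅⁆≤1 : ∀ e → rank M ⁅ e ⁆ ≤ 1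
  rank-⁅⁆≤1 e = ≤-trans (rank-≤ M ⁅ e ⁆) (≤-reflexive (∣⁅x⁆∣≡1 e))

  rank-∪≤ : ∀ X Y → rank M (X ∪ Y) ≤ rank M X + rank M Y
  rank-∪≤ X Y = ≤-trans (m≤m+n _ _) (rank-submod M X Y)

  rank-∪⁅⁆≤ : ∀ X e → rank M (X ∪ ⁅ e ⁆) ≤ suc (rank M X)
  rank-∪⁅⁆≤ X e = ≤-trans (rank-∪≤ X ⁅ e ⁆)
    (≤-trans (+-monoʳ-≤ (rank M X) (rank-⁅⁆≤1 e)) (≤-reflexive (+-comm _ 1)))

  rank-setOf≤ : ∀ xs → rank M (setOf xs) ≤ length xs
  rank-setOf≤ [] = ≤-reflexive rank-⊥
  rank-setOf≤ (x ∷ xs) = ≤-trans (rank-∪≤ ⁅ x ⁆ (setOf xs)) (+-mono-≤ (rank-⁅⁆≤1 x) (rank-setOf≤ xs))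

  rank-≤-cover : ∀ {X Z} xs → X ⊆ Z ∪ setOf xs → rank M X ≤ rank M Z + length xs
  rank-≤-cover {X} {Z} xs sub = ≤-trans (rank-mono M _ _ sub)
    (≤-trans (rank-∪≤ Z (setOf xs)) (+-monoʳ-≤ (rank M Z) (rank-setOf≤ xs)))

  -- Submodularity for `X ∪ Z` and `Y`: their union contains `Y ∪ Z` and their intersection contains
  -- `X`.
  rank-diminishing : ∀ {X Y} Z → X ⊆ Y → rank M (Y ∪ Z) + rank M X ≤ rank M (X ∪ Z) + rank M Y
  rank-diminishing {X} {Y} Z X⊆Y = ≤-trans
    (+-mono-≤ (rank-mono M _ _ (∪-lub (q⊆p∪q (X ∪ Z) Y) (p⊆p∪q Y ∘ q⊆p∪q X Z)))
              (rank-mono M _ _ (λ p → x∈p∩q⁺ (p⊆p∪q Z p , X⊆Y p))))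
    (rank-submod M (X ∪ Z) Y)

  spans-mono : ∀ {X Y e} → X ⊆ Y → Spans X e → Spans Y e
  spans-mono {X} {Y} {e} X⊆Y s = ≤-antisym
    (+-cancelʳ-≤ (rank M X) _ _ (≤-trans (rank-diminishing ⁅ e ⁆ X⊆Y)
      (≤-reflexive (trans (cong (_+ rank M Y) s) (+-comm _ (rank M Y))))))
    (rank-mono M _ _ (p⊆p∪q ⁅ e ⁆))

  ∈⇒spans : ∀ {X e} → e ∈ X → Spans X e
  ∈⇒spans {X} e∈X = cong (rank M) (⊆-antisym (∪-lub id (⁅⁆⊆ e∈X)) (p⊆p∪q _))

  -- The elements of `Y` are added one at a time; by `spans-mono` each is still spanned after the
  -- others have been added.
  rank-∪-spanned : ∀ X Y → (∀ {y} → y ∈ Y → Spans X y) → rank M (X ∪ Y) ≡ rank M X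
  rank-∪-spanned X Y sp = ≤-antisym
    (≤-trans (rank-mono M _ _ (∪-mono id (∈-setOf⁺ ∘ ∈-elements⁺)))
             (go (elements Y) (sp ∘ ∈-elements⁻)))
    (rank-mono M _ _ (p⊆p∪q Y))
    where
    go : ∀ ys → (∀ {y} → y ∈ₗ ys → Spans X y) → rank M (X ∪ setOf ys) ≤ rank M X
    go [] _ = rank-mono M _ _ (∪-lub id (⊥-elim ∘ ∉⊥))
    go (y ∷ ys) sp = ≤-trans
      (rank-mono M _ ((X ∪ setOf ys) ∪ ⁅ y ⁆)
        (∪-lub (p⊆p∪q ⁅ y ⁆ ∘ p⊆p∪q (setOf ys))
               (∪-lub (q⊆p∪q (X ∪ setOf ys) ⁅ y ⁆) (p⊆p∪q ⁅ y ⁆ ∘ q⊆p∪q X (setOf ys)))))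
      (≤-trans (≤-reflexive (spans-mono (p⊆p∪q (setOf ys)) (sp (here refl))))
               (go ys (sp ∘ there)))

  closure : Subset ν → Subset ν
  closure X = tabulate λ e → does (rank M (X ∪ ⁅ e ⁆) ≟ rank M X)

  ∈-closure⁺ : ∀ {X e} → Spans X e → e ∈ closure X
  ∈-closure⁺ {X} {e} s = ∈-tabulate⁺ (dec-true (_ ≟ _) s)

  ∈-closure⁻ : ∀ {X e} → e ∈ closure X → Spans X e
  ∈-closure⁻ {X} {e} p = does-true (_ ≟ _) (∈-tabulate⁻ {f = λ e → does (rank M (X ∪ ⁅ e ⁆) ≟ rank M X)} p)

  ⊆closure : ∀ {X} → X ⊆ closure X
  ⊆closure = ∈-closure⁺ ∘ ∈⇒spans

  rank-closure : ∀ X → rank M (closure X) ≡ rank M X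
  rank-closure X = ≤-antisym
    (≤-trans (rank-mono M _ _ (q⊆p∪q X (closure X))) (≤-reflexive (rank-∪-spanned X (closure X) ∈-closure⁻)))
    (rank-mono M _ _ ⊆closure)

  closure-flat : ∀ X → IsFlat M (closure X)
  closure-flat X e e∉ = begin-strict
    rank M (closure X)         ≡⟨ rank-closure X ⟩
    rank M X                   <⟨ ≤∧≢⇒< (rank-mono M _ _ (p⊆p∪q ⁅ e ⁆)) (e∉ ∘ ∈-closure⁺ ∘ sym) ⟩
    rank M (X ∪ ⁅ e ⁆)         ≤⟨ rank-mono M _ _ (∪-mono ⊆closure id) ⟩
    rank M (closure X ∪ ⁅ e ⁆) ∎
    where open ≤-Reasoning

  flat-spanned : ∀ {F e} → IsFlat M F → Spans F e → e ∈ F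
  flat-spanned {F} {e} fl s with e ∈? F
  ... | yes p = p
  ... | no ¬p = ⊥-elim (<-irrefl (sym s) (fl e ¬p))

  closure-least : ∀ {X F} → IsFlat M F → X ⊆ F → closure X ⊆ F
  closure-least fl X⊆F p = flat-spanned fl (spans-mono X⊆F (∈-closure⁻ p))

  flat-≡ : ∀ {F G} → IsFlat M F → F ⊆ G → rank M G ≤ rank M F → F ≡ G
  flat-≡ {F} {G} fl F⊆G le = ⊆-antisym F⊆G λ {e} e∈G → flat-spanned fl
    (≤-antisym (≤-trans (rank-mono M _ _ (∪-lub F⊆G (⁅⁆⊆ e∈G))) le) (rank-mono M _ _ (p⊆p∪q ⁅ e ⁆)))

  ⊤-flat : IsFlat M ⊤
  ⊤-flat e e∉ = ⊥-elim (e∉ ∈⊤)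

  -- `W - e` spans `e` because `W` is cyclic, hence so does the larger set `X - e`.
  cyclic-subset-remove : ∀ {W X e} → IsCyclic M W → W ⊆ X → e ∈ W → rank M (X - e) ≡ rank M X
  cyclic-subset-remove {W} {X} {e} cW W⊆X e∈W = ≤-antisym (rank-mono M _ _ (proj₁ ∘ ∈-remove⁻ {X = X}))
    (≤-trans (rank-mono M _ _ (⊆remove∪ {X = X} {e}))
      (≤-reflexive (spans-mono {W - e} W-e⊆X-e
        (≤-antisym (≤-trans (rank-mono M _ _ (∪-lub (proj₁ ∘ ∈-remove⁻ {X = W}) (⁅⁆⊆ e∈W))) (≤-reflexive (sym (cW e e∈W))))
                   (rank-mono M _ _ (p⊆p∪q ⁅ e ⁆))))))
    where
    W-e⊆X-e : W - e ⊆ X - e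
    W-e⊆X-e q with ∈-remove⁻ {X = W} q
    ... | q∈W , q≢e = x∈p∧x≢y⇒x∈p-y (W⊆X q∈W) q≢e

  cyclic-∪ : ∀ {X Y} → IsCyclic M X → IsCyclic M Y → IsCyclic M (X ∪ Y)
  cyclic-∪ {X} {Y} cX cY e e∈ with x∈p∪q⁻ X Y e∈
  ... | inj₁ p = cyclic-subset-remove cX (p⊆p∪q Y) p
  ... | inj₂ p = cyclic-subset-remove cY (q⊆p∪q X Y) p

  -- Elements of `X` are covered by `cyclic-subset-remove`. Removing any other element leaves a set
  -- that contains `X` and so has full rank.
  closure-cyclic : ∀ {X} → IsCyclic M X → IsCyclic M (closure X)
  closure-cyclic {X} cX e e∈ with e ∈? X
  ... | yes p = cyclic-subset-remove cX ⊆closure p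
  ... | no ¬p = ≤-antisym (rank-mono M _ _ (proj₁ ∘ ∈-remove⁻ {X = closure X}))
    (≤-trans (≤-reflexive (rank-closure X))
             (rank-mono M _ _ (λ q → x∈p∧x≢y⇒x∈p-y (⊆closure q) (λ { refl → ¬p q }))))

  closure-cyclicFlat : ∀ {X} → IsCyclic M X → IsCyclicFlat M (closure X)
  closure-cyclicFlat cX = closure-cyclic cX , closure-flat _

  cyclic? : ∀ X → Dec (IsCyclic M X)
  cyclic? X = all? λ e → (e ∈? X) →-dec (_ ≟ _)

  cyclicFlat? : ∀ X → Dec (IsCyclicFlat M X)
  cyclicFlat? X = cyclic? X ×-dec all? λ e → ¬? (e ∈? X) →-dec (_ <? _)

  -- The minimum of r(Z) + |X ∖ Z| over cyclic flats Z is attained: coloops are removed one by one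
  -- and collected in `xs` until a cyclic set is left, and `Z` is its closure.
  cyclicFlat-cover : ∀ X → ∃ λ Z → ∃ λ xs → IsCyclicFlat M Z × X ⊆ Z ∪ setOf xs × rank M X ≡ rank M Z + length xs
  cyclicFlat-cover X = go ∣ X ∣ X ≤-refl
    where
    go : ∀ s X → ∣ X ∣ ≤ s → ∃ λ Z → ∃ λ xs → IsCyclicFlat M Z × X ⊆ Z ∪ setOf xs × rank M X ≡ rank M Z + length xs
    go s X le with cyclic? X
    ... | yes cX = closure X , [] , closure-cyclicFlat cX , p⊆p∪q ⊥ ∘ ⊆closure
                 , trans (sym (rank-closure X)) (sym (+-identityʳ _))
    ... | no ¬cX with ¬∀⟶∃¬ ν _ (λ e → (e ∈? X) →-dec (_ ≟ _)) ¬cX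
    ... | e , ¬p with e ∈? X
    ... | no e∉ = ⊥-elim (¬p (⊥-elim ∘ e∉))
    go zero X le | no ¬cX | e , ¬p | yes e∈ = ⊥-elim (<⇒≱ (x∈p⇒∣p-x∣<∣p∣ e∈) (≤-trans le z≤n))
    go (suc s) X le | no ¬cX | e , ¬p | yes e∈
      with go s (X - e) (≤-pred (≤-trans (x∈p⇒∣p-x∣<∣p∣ e∈) le))
    ... | Z , xs , cf , sub , eq = Z , e ∷ xs , cf
      , (λ p → ∪-lub (∪-mono id (q⊆p∪q ⁅ e ⁆ (setOf xs)) ∘ sub) (q⊆p∪q Z _ ∘ p⊆p∪q (setOf xs)) (⊆remove∪ {X = X} {e} p))
      -- Deleting the coloop `e` lowers the rank by exactly one.
      , trans (≤-antisym (≤-trans (rank-mono M _ _ (⊆remove∪ {X = X} {e})) (rank-∪⁅⁆≤ (X - e) e))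
                         (≤∧≢⇒< (rank-mono M _ _ (proj₁ ∘ ∈-remove⁻ {X = X})) (λ q → ¬p (λ _ → q))))
              (trans (cong suc eq) (sym (+-suc _ _)))

-- Counting in lists

count : ∀ {A : Set} → (A → Bool) → List A → ℕ
count p xs = length (filterᵇ p xs)

module _ {A : Set} where

  count-cong : ∀ {p q : A → Bool} xs → (∀ {x} → x ∈ₗ xs → p x ≡ q x) → count p xs ≡ count q xs
  count-cong [] eq = refl
  count-cong {p} {q} (x ∷ xs) eq with p x | q x | eq (here refl)
  ... | true  | _ | refl = cong suc (count-cong xs (eq ∘ there))
  ... | false | _ | refl = count-cong xs (eq ∘ there)

  count-↭ : ∀ (p : A → Bool) {xs ys} → xs ↭ ys → count p xs ≡ count p ys
  count-↭ p = ↭-length ∘ filter-↭ (T? ∘ p)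

  count-map : ∀ {B : Set} (p : A → Bool) (f : B → A) xs → count p (map f xs) ≡ count (p ∘ f) xs
  count-map p f [] = refl
  count-map p f (x ∷ xs) with p (f x)
  ... | true  = cong suc (count-map p f xs)
  ... | false = count-map p f xs

  count-split : ∀ (p q : A → Bool) xs →
                count p xs ≡ count (λ x → q x ∧ p x) xs + count (λ x → not (q x) ∧ p x) xs
  count-split p q [] = refl
  count-split p q (x ∷ xs) with p x | q x
  ... | true  | true  = cong suc (count-split p q xs)
  ... | true  | false = trans (cong suc (count-split p q xs)) (sym (+-suc _ _))
  ... | false | true  = count-split p q xs
  ... | false | false = count-split p q xs

  count-∧ : ∀ (p q : A → Bool) xs → count (λ x → p x ∧ q x) xs ≡ count q (filterᵇ p xs)
  count-∧ p q [] = refl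
  count-∧ p q (x ∷ xs) with p x
  ... | false = count-∧ p q xs
  ... | true with q x
  ...   | true  = cong suc (count-∧ p q xs)
  ...   | false = count-∧ p q xs

  count>0⇒∈ : ∀ (p : A → Bool) xs → 1 ≤ count p xs → ∃ λ x → x ∈ₗ xs × p x ≡ true
  count>0⇒∈ p (x ∷ xs) le with p x in eq
  ... | true  = x , here refl , eq
  ... | false with count>0⇒∈ p xs le
  ...   | y , y∈ , py = y , there y∈ , py

  ∈⇒count>0 : ∀ (p : A → Bool) {xs x} → x ∈ₗ xs → p x ≡ true → 1 ≤ count p xs
  ∈⇒count>0 p {y ∷ _} (here refl) px rewrite px = s≤s z≤n
  ∈⇒count>0 p {y ∷ _} (there x∈)  px with p y
  ... | true  = s≤s z≤n
  ... | false = ∈⇒count>0 p x∈ px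

  count-reindex : ∀ (p : A → Bool) (f : A → A) {xs} → Unique xs → (∀ {x y} → f x ≡ f y → x ≡ y) →
                  (∀ {x} → x ∈ₗ xs → f x ∈ₗ xs) → count (p ∘ f) xs ≡ count p xs
  count-reindex p f {xs} u inj closed = trans (sym (count-map p f xs)) (sym (count-↭ p
    (unique-⊆-length⇒↭ (Uniq.map⁺ inj u) image⊆ (≤-reflexive (sym (length-map f xs))))))
    where
    image⊆ : ∀ {y} → y ∈ₗ map f xs → y ∈ₗ xs
    image⊆ y∈ with ∈-map⁻ f y∈
    ... | x , x∈ , refl = closed x∈

  module _ (_≟A_ : DecidableEquality A) where

    -- Turns equality of all coefficients of two formal sums into a matching of their terms.
    counts⇒↭ : ∀ xs ys → (∀ s → count (λ x → does (x ≟A s)) xs ≡ count (λ x → does (x ≟A s)) ys) → xs ↭ ys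
    counts⇒↭ [] [] _ = ↭-refl
    counts⇒↭ [] (y ∷ ys) eq with () ← subst (1 ≤_) (sym (eq y))
      (∈⇒count>0 (λ x → does (x ≟A y)) {y ∷ ys} (here refl) (dec-true (y ≟A y) refl))
    counts⇒↭ (x ∷ xs) ys eq with count>0⇒∈ (λ z → does (z ≟A x)) ys
      (subst (1 ≤_) (eq x) (∈⇒count>0 (λ z → does (z ≟A x)) {x ∷ xs} (here refl) (dec-true (x ≟A x) refl)))
    ... | z , z∈ , z≡x with does-true (z ≟A x) z≡x
    ... | refl with ∈-∃++ z∈
    ... | as , bs , refl = ↭-trans (prep x (counts⇒↭ xs (as ++ bs) eq′)) (↭-sym (shift x as bs))
      where
      cancel : ∀ s → count (λ x → does (x ≟A s)) (x ∷ xs) ≡ count (λ x → does (x ≟A s)) (x ∷ as ++ bs) →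
               count (λ x → does (x ≟A s)) xs ≡ count (λ x → does (x ≟A s)) (as ++ bs)
      cancel s e with does (x ≟A s)
      ... | true  = suc-injective e
      ... | false = e
      eq′ : ∀ s → count (λ x → does (x ≟A s)) xs ≡ count (λ x → does (x ≟A s)) (as ++ bs)
      eq′ s = cancel s (trans (eq s) (count-↭ (λ x → does (x ≟A s)) (shift x as bs)))

sumOver : ∀ {A : Set} → (A → ℕ) → List A → ℕ
sumOver f xs = sum (map f xs)

sumOver-cong : ∀ {A : Set} {f g : A → ℕ} xs → (∀ {x} → x ∈ₗ xs → f x ≡ g x) → sumOver f xs ≡ sumOver g xs
sumOver-cong [] _ = refl
sumOver-cong (x ∷ xs) eq = cong₂ _+_ (eq (here refl)) (sumOver-cong xs (eq ∘ there))

sumOver-const : ∀ {A : Set} c (xs : List A) → sumOver (λ _ → c) xs ≡ length xs * c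
sumOver-const c [] = refl
sumOver-const c (x ∷ xs) = cong (c +_) (sumOver-const c xs)

sumOver-count-∷ : ∀ {A B : Set} (r : A → B → Bool) x xs ys →
                  sumOver (λ y → count (λ x → r x y) (x ∷ xs)) ys
                  ≡ count (r x) ys + sumOver (λ y → count (λ x → r x y) xs) ys
sumOver-count-∷ r x xs [] = refl
sumOver-count-∷ r x xs (y ∷ ys) with r x y
... | true  = cong suc (trans (cong (count (λ x → r x y) xs +_) (sumOver-count-∷ r x xs ys)) (x∙yz≈y∙xz (count (λ x → r x y) xs) (count (r x) ys) (sumOver (λ y → count (λ x → r x y) xs) ys)))
... | false = trans (cong (count (λ x → r x y) xs +_) (sumOver-count-∷ r x xs ys)) (x∙yz≈y∙xz (count (λ x → r x y) xs) (count (r x) ys) (sumOver (λ y → count (λ x → r x y) xs) ys))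

-- Double counting of the pairs related by `r`. It will exchange the sum over Sym(E) with the one
-- over the permutations of E(Q).
sumOver-count-swap : ∀ {A B : Set} (r : A → B → Bool) xs ys →
                     sumOver (λ x → count (r x) ys) xs ≡ sumOver (λ y → count (λ x → r x y) xs) ys
sumOver-count-swap r [] ys = sym (trans (sumOver-const 0 ys) (*-zeroʳ (length ys)))
sumOver-count-swap r (x ∷ xs) ys =
  trans (cong (count (r x) ys +_) (sumOver-count-swap r xs ys)) (sym (sumOver-count-∷ r x xs ys))

-- Permutations as vectors of distinct elements

concatMap-map : ∀ {A B C : Set} (f : A → B → C) xs ys →
                concatMap (λ x → map (f x) ys) xs ≡ cartesianProductWith f xs ys
concatMap-map f [] ys = refl
concatMap-map f (x ∷ xs) ys = cong (map (f x) ys ++_) (concatMap-map f xs ys)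

∈-vecs : ∀ {k l} (v : Vec (Fin k) l) → v ∈ₗ vecs k l
∈-vecs [] = here refl
∈-vecs {k} {suc l} (x ∷ v) = subst (x ∷ v ∈ₗ_) (sym (concatMap-map _∷_ (allFin k) (vecs k l)))
  (∈-cartesianProductWith⁺ _∷_ (∈-allFin x) (∈-vecs v))

vecs-unique : ∀ k l → Unique (vecs k l)
vecs-unique k zero = [] ∷ []
vecs-unique k (suc l) = subst Unique (sym (concatMap-map _∷_ (allFin k) (vecs k l)))
  (Uniq.cartesianProductWith⁺ _∷_ Vecₚ.∷-injective (Uniq.allFin⁺ k) (vecs-unique k l))

module _ {k : ℕ} where

  any≡false : ∀ {x : Fin k} ys → All (x ≢_) ys → any (λ y → does (x Data.Fin.≟ y)) ys ≡ false
  any≡false [] [] = refl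
  any≡false {x} (y ∷ ys) (x≢y ∷ ps) rewrite dec-false (x Data.Fin.≟ y) x≢y = any≡false ys ps

  any≡false⁻ : ∀ {x : Fin k} ys → any (λ y → does (x Data.Fin.≟ y)) ys ≡ false → All (x ≢_) ys
  any≡false⁻ [] _ = []
  any≡false⁻ {x} (y ∷ ys) eq with x Data.Fin.≟ y
  ... | no x≢y = x≢y ∷ any≡false⁻ ys eq

  unique⇒distinct : ∀ {l} {v : Vec (Fin k) l} → Unique (toList v) → distinct v ≡ true
  unique⇒distinct {v = []} _ = refl
  unique⇒distinct {v = x ∷ v} (x∉ ∷ u) rewrite any≡false (toList v) x∉ = unique⇒distinct u

  distinct⇒unique : ∀ {l} {v : Vec (Fin k) l} → distinct v ≡ true → Unique (toList v)
  distinct⇒unique {v = []} _ = []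
  distinct⇒unique {v = x ∷ v} d with any (λ y → does (x Data.Fin.≟ y)) (toList v) in eq
  ... | false = any≡false⁻ (toList v) eq ∷ distinct⇒unique d

perms : ∀ k → List (Vec (Fin k) k)
perms k = filterᵇ distinct (vecs k k)

module _ {k : ℕ} where

  ∈-perms⁺ : ∀ {v : Vec (Fin k) k} → Unique (toList v) → v ∈ₗ perms k
  ∈-perms⁺ u = ∈-filter⁺ (T? ∘ distinct) (∈-vecs _) (Equivalence.from T-≡ (unique⇒distinct u))

  ∈-perms⁻ : ∀ {v : Vec (Fin k) k} → v ∈ₗ perms k → Unique (toList v)
  ∈-perms⁻ v∈ = distinct⇒unique (Equivalence.to T-≡ (proj₂ (∈-filter⁻ (T? ∘ distinct) {xs = vecs k k} v∈)))

  perms-unique : Unique (perms k)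
  perms-unique = Uniq.filter⁺ (T? ∘ distinct) (vecs-unique k k)

  length-toList : ∀ {l} (v : Vec (Fin k) l) → length (toList v) ≡ l
  length-toList [] = refl
  length-toList (x ∷ v) = cong suc (length-toList v)

  lookup-injective : ∀ {l} {v : Vec (Fin k) l} → Unique (toList v) → ∀ {i j} → lookup v i ≡ lookup v j → i ≡ j
  lookup-injective {v = x ∷ v} _ {zero} {zero} _ = refl
  lookup-injective {v = x ∷ v} (x∉ ∷ _) {zero} {suc j} eq =
    ⊥-elim (All.lookup x∉ (subst (_∈ₗ toList v) (sym eq) (VecMemₚ.∈-toList⁺ (VecMemₚ.∈-lookup j v))) refl)
  lookup-injective {v = x ∷ v} (x∉ ∷ _) {suc i} {zero} eq =
    ⊥-elim (All.lookup x∉ (subst (_∈ₗ toList v) eq (VecMemₚ.∈-toList⁺ (VecMemₚ.∈-lookup i v))) refl)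
  lookup-injective {v = x ∷ v} (_ ∷ u) {suc i} {suc j} eq = cong suc (lookup-injective u eq)

  perm-surjective : ∀ {v : Vec (Fin k) k} → Unique (toList v) → ∀ x → x ∈ₗ toList v
  perm-surjective {v} u x = ∈-resp-↭
    (unique-⊆-length⇒↭ u (λ {y} _ → ∈-allFin y)
      (≤-reflexive (trans (length-tabulate id) (sym (length-toList v)))))
    (∈-allFin x)

  ∈-toList⇒lookup : ∀ {l} (v : Vec (Fin k) l) {x} → x ∈ₗ toList v → ∃ λ i → lookup v i ≡ x
  ∈-toList⇒lookup (y ∷ v) (here refl) = zero , refl
  ∈-toList⇒lookup (y ∷ v) (there x∈) with ∈-toList⇒lookup v x∈
  ... | i , eq = suc i , eq

  vecFromList : ∀ (xs : List (Fin k)) → length xs ≡ k → ∃ λ (v : Vec (Fin k) k) → toList v ≡ xs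
  vecFromList xs len = go xs len
    where
    go : ∀ {l} (xs : List (Fin k)) → length xs ≡ l → ∃ λ (v : Vec (Fin k) l) → toList v ≡ xs
    go []       refl = [] , refl
    go (x ∷ xs) refl with go xs refl
    ... | v , eq = x ∷ v , cong (x ∷_) eq

  map-∈-perms : ∀ {f : Fin k → Fin k} → (∀ {x y} → f x ≡ f y → x ≡ y) →
                ∀ {v} → v ∈ₗ perms k → Vec.map f v ∈ₗ perms k
  map-∈-perms {f} inj {v} v∈ =
    ∈-perms⁺ (subst Unique (sym (Vecₚ.toList-map f v)) (Uniq.map⁺ inj (∈-perms⁻ v∈)))

  perms-nonempty : ∃ λ v → v ∈ₗ perms k
  perms-nonempty with vecFromList (allFin k) (length-tabulate id)
  ... | v , eq = v , ∈-perms⁺ (subst Unique (sym eq) (Uniq.allFin⁺ k))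

map-lookup-injective : ∀ {k l} {τ : Vec (Fin k) l} → (∀ i → i ∈ₗ toList τ) →
  ∀ {ρ σ : Vec (Fin k) k} → Vec.map (lookup ρ) τ ≡ Vec.map (lookup σ) τ → ρ ≡ σ
map-lookup-injective {τ = τ} surj {ρ} {σ} eq = ext ρ σ pointwise
  where
  pointwise : ∀ i → lookup ρ i ≡ lookup σ i
  pointwise i with ∈-toList⇒lookup τ (surj i)
  ... | j , refl = trans (sym (Vecₚ.lookup-map j (lookup ρ) τ))
                         (trans (cong (λ v → lookup v j) eq) (Vecₚ.lookup-map j (lookup σ) τ))
  ext : ∀ {A : Set} {l} (u v : Vec A l) → (∀ i → lookup u i ≡ lookup v i) → u ≡ v
  ext [] [] _ = refl
  ext (x ∷ u) (y ∷ v) p = cong₂ _∷_ (p zero) (ext u v (p ∘ suc))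

-- Ranks along a word

module _ {k : ℕ} where

  open DecMembership (Data.Fin._≟_ {k}) using () renaming (_∈?_ to _∈ₗ?_)

  -- `v` is obtained from `w` by deleting letters that occur in `u` or earlier in `w`, and appending
  -- all letters still missing. `c i` counts the letters that survive among the first `i`.
  word-completion : ∀ (w u : List (Fin k)) → ∃ λ v → Unique v × (∀ {x} → x ∈ₗ v → x ∉ₗ u)
    × (∀ x → x ∈ₗ u ⊎ x ∈ₗ v)
    × ∃ λ (c : ℕ → ℕ) → (∀ i {x} → (x ∈ₗ u ⊎ x ∈ₗ take i w → x ∈ₗ u ⊎ x ∈ₗ take (c i) v)
                                 × (x ∈ₗ u ⊎ x ∈ₗ take (c i) v → x ∈ₗ u ⊎ x ∈ₗ take i w))
  word-completion [] u = List.filter P? (allFin k) , Uniq.filter⁺ P? (Uniq.allFin⁺ k)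
    , (λ x∈ → proj₂ (∈-filter⁻ P? {xs = allFin k} x∈)) , covers
    , (λ _ → 0) , λ { zero → id , id ; (suc i) → id , id }
    where
    P? : ∀ x → Dec (x ∉ₗ u)
    P? x = ¬? (x ∈ₗ? u)
    covers : ∀ x → x ∈ₗ u ⊎ x ∈ₗ List.filter P? (allFin k)
    covers x with x ∈ₗ? u
    ... | yes p = inj₁ p
    ... | no ¬p = inj₂ (∈-filter⁺ P? (∈-allFin x) ¬p)
  word-completion (y ∷ w) u with y ∈ₗ? u
  ... | yes y∈u with word-completion w u
  ...   | v , uv , v∉u , all , c , eqv = v , uv , v∉u , all , c′ , eqv′
    where
    c′ : ℕ → ℕ
    c′ zero    = 0
    c′ (suc i) = c i
    eqv′ : ∀ i {x} → (x ∈ₗ u ⊎ x ∈ₗ take i (y ∷ w) → x ∈ₗ u ⊎ x ∈ₗ take (c′ i) v)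
                   × (x ∈ₗ u ⊎ x ∈ₗ take (c′ i) v → x ∈ₗ u ⊎ x ∈ₗ take i (y ∷ w))
    eqv′ zero = id , id
    eqv′ (suc i) = (λ { (inj₁ p) → inj₁ p
                      ; (inj₂ (here refl)) → inj₁ y∈u
                      ; (inj₂ (there p)) → proj₁ (eqv i) (inj₂ p) })
                 , Sum.map₂ there ∘ proj₂ (eqv i)
  word-completion (y ∷ w) u | no y∉u with word-completion w (y ∷ u)
  ...   | v , uv , v∉u , all , c , eqv =
    y ∷ v
    , All.tabulate (λ x∈ → λ { refl → v∉u x∈ (here refl) }) ∷ uv
    , (λ { (here refl) → y∉u ; (there p) q → v∉u p (there q) })
    , (λ x → shuffle (all x)) , c′ , eqv′
    where
    shuffle : ∀ {x : Fin k} {v} → x ∈ₗ y ∷ u ⊎ x ∈ₗ v → x ∈ₗ u ⊎ x ∈ₗ y ∷ v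
    shuffle (inj₁ (here refl)) = inj₂ (here refl)
    shuffle (inj₁ (there p))   = inj₁ p
    shuffle (inj₂ p)           = inj₂ (there p)
    shuffle⁻ : ∀ {x : Fin k} {v} → x ∈ₗ u ⊎ x ∈ₗ y ∷ v → x ∈ₗ y ∷ u ⊎ x ∈ₗ v
    shuffle⁻ (inj₁ p)           = inj₁ (there p)
    shuffle⁻ (inj₂ (here refl)) = inj₁ (here refl)
    shuffle⁻ (inj₂ (there p))   = inj₂ p
    c′ : ℕ → ℕ
    c′ zero    = 0
    c′ (suc i) = suc (c i)
    eqv′ : ∀ i {x} → (x ∈ₗ u ⊎ x ∈ₗ take i (y ∷ w) → x ∈ₗ u ⊎ x ∈ₗ take (c′ i) (y ∷ v))
                   × (x ∈ₗ u ⊎ x ∈ₗ take (c′ i) (y ∷ v) → x ∈ₗ u ⊎ x ∈ₗ take i (y ∷ w))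
    eqv′ zero = id , id
    eqv′ (suc i) = shuffle ∘ proj₁ (eqv i) ∘ shuffle⁻ , shuffle ∘ proj₂ (eqv i) ∘ shuffle⁻

  ∈[]⊎⇒ : ∀ {x : Fin k} {B : Set} → x ∈ₗ [] ⊎ B → B
  ∈[]⊎⇒ (inj₂ b) = b

  -- Words of supports repeat letters, since all of {e} ∪ T_e has support e. As sets, their prefixes
  -- are nevertheless prefixes of a permutation, to which the G-invariant applies.
  word⇒perm : ∀ (w : List (Fin k)) → ∃ λ (τ : Vec (Fin k) k) → Unique (toList τ)
    × ∃ λ (c : ℕ → ℕ) → ∀ i {x} → (x ∈ₗ take i w → x ∈ₗ take (c i) (toList τ))
                                × (x ∈ₗ take (c i) (toList τ) → x ∈ₗ take i w)
  word⇒perm w with word-completion w []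
  ... | v , uv , _ , all , c , eqv with vecFromList v (trans
          (≤-antisym (unique-⊆⇒length≤ uv (λ {x} _ → ∈-allFin x))
                     (unique-⊆⇒length≤ (Uniq.allFin⁺ k) (λ {x} _ → ∈[]⊎⇒ (all x))))
          (length-tabulate id))
  ... | τ , refl = τ , uv , c , λ i → ∈[]⊎⇒ ∘ proj₁ (eqv i) ∘ inj₂ , ∈[]⊎⇒ ∘ proj₂ (eqv i) ∘ inj₂

setOf-cong : ∀ {k} {xs ys : List (Fin k)} → (∀ {x} → x ∈ₗ xs → x ∈ₗ ys) → (∀ {x} → x ∈ₗ ys → x ∈ₗ xs) →
             setOf xs ≡ setOf ys
setOf-cong f g = ⊆-antisym (∈-setOf⁺ ∘ f ∘ ∈-setOf⁻ _) (∈-setOf⁺ ∘ g ∘ ∈-setOf⁻ _)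

map-⊆ : ∀ {A B : Set} {f : A → B} {xs ys} → (∀ {x} → x ∈ₗ xs → x ∈ₗ ys) →
        ∀ {y} → y ∈ₗ map f xs → y ∈ₗ map f ys
map-⊆ {f = f} sub y∈ with ∈-map⁻ f y∈
... | x , x∈ , refl = ∈-map⁺ f (sub x∈)

-- The sum telescopes; monotonicity of the rank makes the truncated differences exact.
sum-rankSeqFrom : ∀ {k l} (M : Matroid k) S (v : Vec (Fin k) l) j →
  sum (take j (rankSeqFrom M S v)) + rank M S ≡ rank M (S ∪ setOf (take j (toList v)))
sum-rankSeqFrom M S v zero = cong (rank M) (sym (∪-identityʳ S))
sum-rankSeqFrom M S [] (suc j) = cong (rank M) (sym (∪-identityʳ S))
sum-rankSeqFrom M S (x ∷ v) (suc j) = begin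
  rank M (S ∪ ⁅ x ⁆) ∸ rank M S + R + rank M S     ≡⟨ +-assoc (rank M (S ∪ ⁅ x ⁆) ∸ rank M S) R (rank M S) ⟩
  rank M (S ∪ ⁅ x ⁆) ∸ rank M S + (R + rank M S)   ≡⟨ cong (rank M (S ∪ ⁅ x ⁆) ∸ rank M S +_) (+-comm R _) ⟩
  rank M (S ∪ ⁅ x ⁆) ∸ rank M S + (rank M S + R)   ≡⟨ sym (+-assoc (rank M (S ∪ ⁅ x ⁆) ∸ rank M S) (rank M S) R) ⟩
  rank M (S ∪ ⁅ x ⁆) ∸ rank M S + rank M S + R     ≡⟨ cong (_+ R) (m∸n+n≡m (rank-mono M _ _ (p⊆p∪q ⁅ x ⁆))) ⟩
  rank M (S ∪ ⁅ x ⁆) + R                           ≡⟨ +-comm _ R ⟩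
  R + rank M (S ∪ ⁅ x ⁆)                           ≡⟨ sum-rankSeqFrom M (S ∪ ⁅ x ⁆) v j ⟩
  rank M ((S ∪ ⁅ x ⁆) ∪ setOf (take j (toList v))) ≡⟨ cong (rank M) (∪-assoc S ⁅ x ⁆ _) ⟩
  rank M (S ∪ (⁅ x ⁆ ∪ setOf (take j (toList v)))) ∎
  where
  open ≡-Reasoning
  R = sum (take j (rankSeqFrom M (S ∪ ⁅ x ⁆) v))

sum-rankSeq : ∀ {k} (M : Matroid k) v j → sum (take j (rankSeq M v)) ≡ rank M (setOf (take j (toList v)))
sum-rankSeq M v j = begin
  sum (take j (rankSeq M v))                ≡⟨ sym (+-identityʳ _) ⟩
  sum (take j (rankSeq M v)) + 0            ≡⟨ cong (sum (take j (rankSeq M v)) +_) (sym (rank-⊥ M)) ⟩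
  sum (take j (rankSeq M v)) + rank M ⊥     ≡⟨ sum-rankSeqFrom M ⊥ v j ⟩
  rank M (⊥ ∪ setOf (take j (toList v)))    ≡⟨ cong (rank M) (∪-identityˡ _) ⟩
  rank M (setOf (take j (toList v)))        ∎
  where open ≡-Reasoning

-- With this a rank sequence becomes a functional of the ranks of the prefixes, which can be
-- modified at single times.
differences : (ℕ → ℕ) → ℕ → List ℕ
differences f zero    = []
differences f (suc l) = (f 1 ∸ f 0) ∷ differences (f ∘ suc) l

differences-cong : ∀ {f g} l → (∀ i → i ≤ l → f i ≡ g i) → differences f l ≡ differences g l
differences-cong zero    eq = refl
differences-cong (suc l) eq = cong₂ _∷_ (cong₂ _∸_ (eq 1 (s≤s z≤n)) (eq 0 z≤n)) (differences-cong l (λ i i≤ → eq (suc i) (s≤s i≤)))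

rankSeqFrom≡differences : ∀ {k l} (M : Matroid k) S (v : Vec (Fin k) l) →
  rankSeqFrom M S v ≡ differences (λ i → rank M (S ∪ setOf (take i (toList v)))) l
rankSeqFrom≡differences M S [] = refl
rankSeqFrom≡differences {l = suc l} M S (x ∷ v) = cong₂ _∷_
  (cong₂ _∸_ (cong (λ Z → rank M (S ∪ Z)) (sym (∪-identityʳ _))) (cong (rank M) (sym (∪-identityʳ S))))
  (trans (rankSeqFrom≡differences M (S ∪ ⁅ x ⁆) v)
         (differences-cong l (λ i _ → cong (rank M) (∪-assoc S ⁅ x ⁆ _))))

rankSeq≡differences : ∀ {k} (M : Matroid k) v →
  rankSeq M v ≡ differences (λ i → rank M (setOf (take i (toList v)))) k
rankSeq≡differences {k} M v = trans (rankSeqFrom≡differences M ⊥ v)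
  (differences-cong k (λ i _ → cong (rank M) (∪-identityˡ _)))

-- Rank distributions determined by the G-invariant

Gcoeff≡count : ∀ {k} (M : Matroid k) s → Gcoeff M s ≡ count (λ v → does (≡-dec _≟_ (rankSeq M v) s)) (perms k)
Gcoeff≡count {k} M s = count-∧ distinct _ (vecs k k)

length-rankSeqFrom : ∀ {k l} (M : Matroid k) S (v : Vec (Fin k) l) → length (rankSeqFrom M S v) ≡ l
length-rankSeqFrom M S [] = refl
length-rankSeqFrom M S (x ∷ v) = cong suc (length-rankSeqFrom M _ v)

-- The rank sequence of any permutation for `M` has a positive coefficient, so it also occurs for
-- `N`; its length is the size of either ground set.
sameG⇒≡ : ∀ {k k′} (M : Matroid k) (N : Matroid k′) → SameG M N → k ≡ k′
sameG⇒≡ {k} {k′} M N same with perms-nonempty {k}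
... | v , v∈ with count>0⇒∈ _ (perms k′) (subst (1 ≤_)
      (trans (sym (Gcoeff≡count M (rankSeq M v))) (trans (same (rankSeq M v)) (Gcoeff≡count N _)))
      (∈⇒count>0 (λ w → does (≡-dec _≟_ (rankSeq M w) (rankSeq M v))) v∈ (dec-true (≡-dec _≟_ (rankSeq M v) _) refl)))
... | w , _ , eq = trans (sym (length-rankSeqFrom M ⊥ v))
  (trans (cong length (sym (does-true (≡-dec _≟_ (rankSeq N w) (rankSeq M v)) eq))) (length-rankSeqFrom N ⊥ w))

prefixRank : ∀ {k} → Matroid k → List (Fin k) → Vec (Fin k) k → ℕ → ℕ
prefixRank M w σ i = rank M (setOf (map (lookup σ) (take i w)))

module _ {k : ℕ} (M N : Matroid k) (same : SameG M N) where

  -- The rank sequences of all permutations form the same multiset for `M` and for `N`, so any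
  -- property of sequences is equally frequent.
  sameG-rankSeq : ∀ (p : List ℕ → Bool) → count (p ∘ rankSeq M) (perms k) ≡ count (p ∘ rankSeq N) (perms k)
  sameG-rankSeq p = trans (sym (count-map p (rankSeq M) (perms k)))
    (trans (count-↭ p rankSeqs-↭) (count-map p (rankSeq N) (perms k)))
    where
    is : List ℕ → List ℕ → Bool
    is s t = does (≡-dec _≟_ t s)
    rankSeqs-↭ : map (rankSeq M) (perms k) ↭ map (rankSeq N) (perms k)
    rankSeqs-↭ = counts⇒↭ (≡-dec _≟_) _ _ λ s → begin
      count (is s) (map (rankSeq M) (perms k)) ≡⟨ count-map (is s) (rankSeq M) (perms k) ⟩
      count (is s ∘ rankSeq M) (perms k)       ≡⟨ sym (Gcoeff≡count M s) ⟩
      Gcoeff M s                               ≡⟨ same s ⟩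
      Gcoeff N s                               ≡⟨ Gcoeff≡count N s ⟩
      count (is s ∘ rankSeq N) (perms k)       ≡⟨ sym (count-map (is s) (rankSeq N) (perms k)) ⟩
      count (is s) (map (rankSeq N) (perms k)) ∎
      where open ≡-Reasoning

  -- By `word⇒perm` the word may be replaced by a permutation `τ`. As σ runs over all permutations
  -- so does στ, and the prefix ranks are partial sums of the rank sequence of στ. The hypothesis on
  -- `Φ` takes the place of function extensionality.
  sameG-prefixRank : ∀ (Φ : (ℕ → ℕ) → Bool) → (∀ {f g} → (∀ i → f i ≡ g i) → Φ f ≡ Φ g) → ∀ w →
    count (Φ ∘ prefixRank M w) (perms k) ≡ count (Φ ∘ prefixRank N w) (perms k)
  sameG-prefixRank Φ ext w with word⇒perm w
  ... | τ , uτ , c , eqv = trans (viaRankSeq M) (trans (sameG-rankSeq Ψ) (sym (viaRankSeq N)))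
    where
    Ψ : List ℕ → Bool
    Ψ s = Φ (λ i → sum (take (c i) s))
    viaRankSeq : ∀ L → count (Φ ∘ prefixRank L w) (perms k) ≡ count (Ψ ∘ rankSeq L) (perms k)
    viaRankSeq L = trans
      (count-cong (perms k) λ {σ} _ → ext λ i → sym (trans
        (sum-rankSeq L (Vec.map (lookup σ) τ) (c i))
        (cong (rank L) (trans
          (cong (λ l → setOf (take (c i) l)) (Vecₚ.toList-map (lookup σ) τ))
          (trans (cong setOf (take-map (c i) (toList τ)))
            (setOf-cong (map-⊆ (proj₂ (eqv i))) (map-⊆ (proj₁ (eqv i)))))))))
      (count-reindex (Ψ ∘ rankSeq L) (λ σ → Vec.map (lookup σ) τ) perms-unique
        (map-lookup-injective (perm-surjective uτ))
        (λ {σ} σ∈ → ∈-perms⁺ (subst Unique (sym (Vecₚ.toList-map (lookup σ) τ))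
          (Uniq.map⁺ (lookup-injective (∈-perms⁻ σ∈)) uτ))))

-- Images of lists under partial maps

∈-mapMaybe⁺ : ∀ {A B : Set} (f : A → Maybe B) {xs x y} → x ∈ₗ xs → f x ≡ just y → y ∈ₗ mapMaybe f xs
∈-mapMaybe⁺ f {z ∷ _} (here refl) eq rewrite eq = here refl
∈-mapMaybe⁺ f {z ∷ _} (there x∈)  eq with f z
... | just _  = there (∈-mapMaybe⁺ f x∈ eq)
... | nothing = ∈-mapMaybe⁺ f x∈ eq

∈-mapMaybe⁻ : ∀ {A B : Set} (f : A → Maybe B) xs {y} → y ∈ₗ mapMaybe f xs → ∃ λ x → x ∈ₗ xs × f x ≡ just y
∈-mapMaybe⁻ f (z ∷ xs) y∈ with f z in eq
∈-mapMaybe⁻ f (z ∷ xs) (here refl) | just _ = z , here refl , eq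
∈-mapMaybe⁻ f (z ∷ xs) (there y∈) | just _ with ∈-mapMaybe⁻ f xs y∈
... | x , x∈ , fx = x , there x∈ , fx
∈-mapMaybe⁻ f (z ∷ xs) y∈ | nothing with ∈-mapMaybe⁻ f xs y∈
... | x , x∈ , fx = x , there x∈ , fx

mapMaybe-map-commute : ∀ {A B : Set} (f : A → Maybe B) (g : A → A) (h : B → B) →
  (∀ x → f (g x) ≡ Maybe.map h (f x)) → ∀ xs → mapMaybe f (map g xs) ≡ map h (mapMaybe f xs)
mapMaybe-map-commute f g h eq xs = trans (mapMaybe-map f g xs)
  (trans (mapMaybe-cong eq xs) (sym (map-mapMaybe h f xs)))

-- The ground set of the cone

module Cone (n m : ℕ) where

  encode : Kind n m → Fin (suc (n + n * m))
  encode tip       = zero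
  encode (base e)  = suc (e ↑ˡ (n * m))
  encode (tee e j) = suc (n ↑ʳ combine e j)

  decode-encode : ∀ κ → decode m (encode κ) ≡ κ
  decode-encode tip = refl
  decode-encode (base e) rewrite splitAt-↑ˡ n e (n * m) = refl
  decode-encode (tee e j) rewrite splitAt-↑ʳ n (n * m) (combine e j) =
    cong (λ p → tee (proj₁ p) (proj₂ p)) (remQuot-combine e j)

  encode-decode : ∀ x → encode (decode m x) ≡ x
  encode-decode zero = refl
  encode-decode (suc x) with splitAt n x in eq
  ... | inj₁ e = cong suc (splitAt⁻¹-↑ˡ eq)
  ... | inj₂ t = cong suc (trans (cong (n ↑ʳ_) (combine-remQuot {n} m t)) (splitAt⁻¹-↑ʳ eq))

  decode-injective : ∀ {x y} → decode m x ≡ decode m y → x ≡ y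
  decode-injective {x} {y} eq = trans (sym (encode-decode x)) (trans (cong encode eq) (encode-decode y))

  decode⁻ : ∀ {x κ} → decode m x ≡ κ → x ≡ encode κ
  decode⁻ {x} eq = trans (sym (encode-decode x)) (cong encode eq)

  encode-injective : ∀ {κ μ} → encode κ ≡ encode μ → κ ≡ μ
  encode-injective {κ} {μ} eq = trans (sym (decode-encode κ)) (trans (cong (decode m) eq) (decode-encode μ))

  baseOf supportOf : Kind n m → Maybe (Fin n)
  baseOf tip       = nothing
  baseOf (base e)  = just e
  baseOf (tee e j) = nothing
  supportOf tip       = nothing
  supportOf (base e)  = just e
  supportOf (tee e j) = just e

  isExtra : Kind n m → Bool
  isExtra tip       = true
  isExtra (base e)  = false
  isExtra (tee e j) = true

  baseOf⁻ : ∀ {κ e} → baseOf κ ≡ just e → κ ≡ base e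
  baseOf⁻ {base e} refl = refl

  private
    inEmb inQ : Subset n → Kind n m → Bool
    inEmb S tip       = false
    inEmb S (base e)  = lookup S e
    inEmb S (tee e j) = false
    inQ S tip       = true
    inQ S (base e)  = lookup S e
    inQ S (tee e j) = lookup S e

    lookup-embE : ∀ S x → lookup (embE m S) x ≡ inEmb S (decode m x)
    lookup-embE S zero = refl
    -- The lookup is first replaced by the value of the tabulated function, so that the case
    -- distinction on `splitAt n x` reaches both sides.
    lookup-embE S (suc x) with lookup (embE m S) (suc x) | (lookup (embE m S) (suc x) ≡ _ Function.∋ lookup∘tabulate _ x)
    ... | _ | refl with splitAt n x
    ...   | inj₁ e = refl
    ...   | inj₂ t = refl

    lookup-qSet : ∀ S x → lookup (qSet m S) x ≡ inQ S (decode m x)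
    lookup-qSet S zero = refl
    lookup-qSet S (suc x) with lookup (qSet m S) (suc x) | (lookup (qSet m S) (suc x) ≡ _ Function.∋ lookup∘tabulate _ x)
    ... | _ | refl with splitAt n x
    ...   | inj₁ e = refl
    ...   | inj₂ t = refl

  ∈-embE⁺ : ∀ {S e} → e ∈ S → encode (base e) ∈ embE m S
  ∈-embE⁺ {S} {e} e∈ = lookup⇒[]= _ _ (trans (lookup-embE S (encode (base e)))
    (trans (cong (inEmb S) (decode-encode (base e))) ([]=⇒lookup e∈)))

  ∈-embE⁻ : ∀ {S x} → x ∈ embE m S → ∃ λ e → e ∈ S × decode m x ≡ base e
  ∈-embE⁻ {S} {x} x∈ = go (decode m x) (trans (sym (lookup-embE S x)) ([]=⇒lookup x∈))
    where
    go : ∀ κ → inEmb S κ ≡ true → ∃ λ e → e ∈ S × κ ≡ base e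
    go (base e) eq = e , lookup⇒[]= e S eq , refl

  ∈-qSet⁺ : ∀ {S x e} → e ∈ S → supportOf (decode m x) ≡ just e → x ∈ qSet m S
  ∈-qSet⁺ {S} {x} {e} e∈ eq = lookup⇒[]= _ _ (trans (lookup-qSet S x) (go (decode m x) eq))
    where
    go : ∀ κ → supportOf κ ≡ just e → inQ S κ ≡ true
    go (base _)  refl = []=⇒lookup e∈
    go (tee _ _) refl = []=⇒lookup e∈

  tip∈qSet : ∀ {S} → zero ∈ qSet m S
  tip∈qSet {S} = lookup⇒[]= zero _ (lookup-qSet S zero)

  ∈-qSet⁻ : ∀ {S x} → x ∈ qSet m S → x ≡ zero ⊎ ∃ λ e → e ∈ S × supportOf (decode m x) ≡ just e
  ∈-qSet⁻ {S} {x} x∈ = go (decode m x) refl (trans (sym (lookup-qSet S x)) ([]=⇒lookup x∈))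
    where
    go : ∀ κ → decode m x ≡ κ → inQ S κ ≡ true → x ≡ zero ⊎ ∃ λ e → e ∈ S × supportOf (decode m x) ≡ just e
    go tip       dx _  = inj₁ (decode-injective dx)
    go (base e)  dx eq = inj₂ (e , lookup⇒[]= e S eq , cong supportOf dx)
    go (tee e j) dx eq = inj₂ (e , lookup⇒[]= e S eq , cong supportOf dx)

  -- For a list of the elements of X, these list X_E, supp X (with repetitions) and X ∖ E, the tip
  -- being among the extras.
  bases supports extras : List (Fin (suc (n + n * m))) → List _
  bases    = mapMaybe (baseOf ∘ decode m)
  supports = mapMaybe (supportOf ∘ decode m)
  extras   = filterᵇ (isExtra ∘ decode m)

  length-bases-extras : ∀ xs → length (bases xs) + length (extras xs) ≡ length xs
  length-bases-extras [] = refl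
  length-bases-extras (x ∷ xs) with decode {n} m x
  ... | tip     = trans (+-suc _ _) (cong suc (length-bases-extras xs))
  ... | base e  = cong suc (length-bases-extras xs)
  ... | tee e j = trans (+-suc _ _) (cong suc (length-bases-extras xs))

  supportOf-nothing : ∀ {x} → supportOf (decode m x) ≡ nothing → x ≡ zero
  supportOf-nothing {x} eq with decode {n} m x in dx
  ... | tip = decode-injective dx

  bases⊎extras : ∀ {x xs} → x ∈ₗ xs → (∃ λ e → e ∈ₗ bases xs × decode m x ≡ base e) ⊎ x ∈ₗ extras xs
  bases⊎extras {x} {xs} x∈ with decode {n} m x in dx
  ... | base e  = inj₁ (e , ∈-mapMaybe⁺ (baseOf ∘ decode m) x∈ (cong baseOf dx) , refl)
  ... | tip     = inj₂ (∈-filter⁺ (T? ∘ isExtra ∘ decode m) x∈ (subst (T ∘ isExtra) (sym dx) _))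
  ... | tee e j = inj₂ (∈-filter⁺ (T? ∘ isExtra ∘ decode m) x∈ (subst (T ∘ isExtra) (sym dx) _))

-- The rank function of the cone

module _ {n : ℕ} (M : Matroid n) (m : ℕ) (Q : Matroid (suc (n + n * m))) (cone : IsFreeCone M m Q) where

  open Cone n m

  private
    X⇔ = proj₁ cone
    rank-emb = proj₁ (proj₂ cone)
    rank-q = proj₂ (proj₂ cone)

  -- A cyclic flat `Z` of `M` and elements `xs` that attain the rank of `S` carry over to the cyclic
  -- flat `embE m Z` of the cone.
  rank-embE≤ : ∀ S → rank Q (embE m S) ≤ rank M S
  rank-embE≤ S with cyclicFlat-cover M S
  ... | Z , xs , cf , sub , eq = begin
    rank Q (embE m S)                                  ≤⟨ rank-≤-cover Q (map (encode ∘ base) xs) sub′ ⟩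
    rank Q (embE m Z) + length (map (encode ∘ base) xs) ≡⟨ cong₂ _+_ (rank-emb Z cf) (length-map _ xs) ⟩
    rank M Z + length xs                               ≡⟨ sym eq ⟩
    rank M S                                           ∎
    where
    open ≤-Reasoning
    sub′ : embE m S ⊆ embE m Z ∪ setOf (map (encode ∘ base) xs)
    sub′ {x} x∈ with ∈-embE⁻ {S} x∈
    ... | e , e∈S , dx with decode⁻ {x} dx
    ... | refl with x∈p∪q⁻ Z (setOf xs) (sub e∈S)
    ...   | inj₁ e∈Z = x∈p∪q⁺ (inj₁ (∈-embE⁺ e∈Z))
    ...   | inj₂ e∈xs = x∈p∪q⁺ (inj₂ (∈-setOf⁺ (∈-map⁺ (encode ∘ base) (∈-setOf⁻ xs e∈xs))))

  rank-cone≤bases : ∀ l → rank Q (setOf l) ≤ rank M (setOf (bases l)) + length (extras l)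
  rank-cone≤bases l = ≤-trans (rank-≤-cover Q {Z = embE m (setOf (bases l))} (extras l) sub)
    (+-monoˡ-≤ _ (rank-embE≤ _))
    where
    sub : setOf l ⊆ embE m (setOf (bases l)) ∪ setOf (extras l)
    sub {x} x∈ with bases⊎extras (∈-setOf⁻ l x∈)
    ... | inj₁ (e , e∈ , dx) = x∈p∪q⁺ (inj₁ (subst (_∈ _) (sym (decode⁻ {x} dx))
                                 (∈-embE⁺ (∈-setOf⁺ e∈))))
    ... | inj₂ x∈ex = x∈p∪q⁺ (inj₂ (∈-setOf⁺ x∈ex))

  rank-cone≤supports : ∀ l → rank Q (setOf l) ≤ suc (rank M (setOf (supports l)))
  rank-cone≤supports l with supports l in eq
  -- Without supports there is no nonempty flat to take the cone over, but then the set is contained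
  -- in the singleton of the tip.
  ... | [] = ≤-trans (rank-mono Q _ ⁅ zero ⁆ only-tip) (≤-trans (rank-⁅⁆≤1 Q zero) (s≤s z≤n))
    where
    only-tip : setOf l ⊆ ⁅ zero ⁆
    only-tip {x} x∈ with supportOf (decode m x) in sx
    ... | nothing = subst (_∈ ⁅ zero ⁆) (sym (supportOf-nothing sx)) (x∈⁅x⁆ zero)
    ... | just e with () ← subst (e ∈ₗ_) eq (∈-mapMaybe⁺ (supportOf ∘ decode m) (∈-setOf⁻ l x∈) sx)
  ... | e ∷ es = begin
    rank Q (setOf l)                        ≤⟨ rank-mono Q _ _ sub ⟩
    rank Q (qSet m F)                       ≡⟨ rank-q F (closure-flat M _) (e , ⊆closure M (∈-setOf⁺ {xs = e ∷ es} (here refl))) ⟩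
    suc (rank M F)                          ≡⟨ cong suc (rank-closure M _) ⟩
    suc (rank M (setOf (e ∷ es)))           ∎
    where
    open ≤-Reasoning
    F = closure M (setOf (e ∷ es))
    sub : setOf l ⊆ qSet m F
    sub {x} x∈ with supportOf (decode m x) in sx
    ... | nothing = subst (_∈ qSet m F) (sym (supportOf-nothing sx)) (tip∈qSet)
    ... | just f  = ∈-qSet⁺ (⊆closure M (∈-setOf⁺ (subst (f ∈ₗ_) eq (∈-mapMaybe⁺ (supportOf ∘ decode m) (∈-setOf⁻ l x∈) sx)))) sx

  -- A cyclic flat of `Q` that attains the rank is of one of two kinds, which give the two
  -- alternatives. If it is `embE m Z`, it contains no extras, so all extras of `l` are among the
  -- added elements `xs`; if it is `qSet m F`, all supports lie in `F` or come from `xs`.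
  rank-cone≥ : ∀ l → Unique l → rank M (setOf (bases l)) + length (extras l) ≤ rank Q (setOf l)
                              ⊎ suc (rank M (setOf (supports l))) ≤ rank Q (setOf l)
  rank-cone≥ l u with cyclicFlat-cover Q (setOf l)
  ... | X , xs , cf , sub , eq with proj₁ (X⇔ X) cf
  ... | inj₁ (Z , cfZ , refl) = inj₁ (begin
    rank M (setOf (bases l)) + length (extras l)            ≤⟨ +-mono-≤ (rank-≤-cover M (bases xs) subB) (unique-⊆⇒length≤ (Uniq.filter⁺ _ u) subE) ⟩
    rank M Z + length (bases xs) + length (extras xs)       ≡⟨ +-assoc (rank M Z) _ _ ⟩
    rank M Z + (length (bases xs) + length (extras xs))     ≡⟨ cong (rank M Z +_) (length-bases-extras xs) ⟩
    rank M Z + length xs                                        ≡⟨ cong (_+ length xs) (sym (rank-emb Z cfZ)) ⟩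
    rank Q (embE m Z) + length xs                               ≡⟨ sym eq ⟩
    rank Q (setOf l)                                            ∎)
    where
    open ≤-Reasoning
    subB : setOf (bases l) ⊆ Z ∪ setOf (bases xs)
    subB {e} e∈ with ∈-mapMaybe⁻ (baseOf ∘ decode m) l (∈-setOf⁻ _ e∈)
    ... | x , x∈l , bx with x∈p∪q⁻ (embE m Z) (setOf xs) (sub (∈-setOf⁺ x∈l))
    ...   | inj₂ x∈xs = x∈p∪q⁺ (inj₂ (∈-setOf⁺ (∈-mapMaybe⁺ (baseOf ∘ decode m) (∈-setOf⁻ xs x∈xs) bx)))
    ...   | inj₁ x∈Z with ∈-embE⁻ {Z} x∈Z
    ...     | f , f∈Z , dx with trans (sym bx) (cong (baseOf) dx)
    ...       | refl = x∈p∪q⁺ (inj₁ f∈Z)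
    subE : ∀ {x} → x ∈ₗ extras l → x ∈ₗ extras xs
    subE {x} x∈ with ∈-filter⁻ (T? ∘ isExtra ∘ decode m) {xs = l} x∈
    ... | x∈l , ex with x∈p∪q⁻ (embE m Z) (setOf xs) (sub (∈-setOf⁺ x∈l))
    ...   | inj₂ x∈xs = ∈-filter⁺ (T? ∘ isExtra ∘ decode m) (∈-setOf⁻ xs x∈xs) ex
    ...   | inj₁ x∈Z with ∈-embE⁻ {Z} x∈Z
    ...     | f , _ , dx = ⊥-elim (subst (T ∘ isExtra) dx ex)
  ... | inj₂ (F , fl , ne , refl) = inj₂ (begin
    suc (rank M (setOf (supports l)))             ≤⟨ s≤s (rank-≤-cover M (supports xs) subS) ⟩
    suc (rank M F) + length (supports xs)         ≤⟨ +-monoʳ-≤ (suc (rank M F)) (length-mapMaybe _ xs) ⟩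
    suc (rank M F) + length xs                      ≡⟨ cong (_+ length xs) (sym (rank-q F fl ne)) ⟩
    rank Q (qSet m F) + length xs                   ≡⟨ sym eq ⟩
    rank Q (setOf l)                                ∎)
    where
    open ≤-Reasoning
    subS : setOf (supports l) ⊆ F ∪ setOf (supports xs)
    subS {e} e∈ with ∈-mapMaybe⁻ (supportOf ∘ decode m) l (∈-setOf⁻ _ e∈)
    ... | x , x∈l , sx with x∈p∪q⁻ (qSet m F) (setOf xs) (sub (∈-setOf⁺ x∈l))
    ...   | inj₂ x∈xs = x∈p∪q⁺ (inj₂ (∈-setOf⁺ (∈-mapMaybe⁺ (supportOf ∘ decode m) (∈-setOf⁻ xs x∈xs) sx)))
    ...   | inj₁ x∈q with ∈-qSet⁻ {F} x∈q
    ...     | inj₁ refl with () ← sx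
    ...     | inj₂ (f , f∈F , sf) with trans (sym sx) sf
    ...       | refl = x∈p∪q⁺ (inj₁ f∈F)

  rank-cone : ∀ l → Unique l → rank Q (setOf l)
              ≡ (rank M (setOf (bases l)) + length (extras l)) ⊓ suc (rank M (setOf (supports l)))
  rank-cone l u = ≤-antisym (⊓-glb (rank-cone≤bases l) (rank-cone≤supports l))
    ([ ≤-trans (m⊓n≤m _ _) , ≤-trans (m⊓n≤n _ _) ]′ (rank-cone≥ l u))

-- Prefixes of lists and boolean comparison

take-suc-view : ∀ {X : Set} i (l : List X) → take (suc i) l ≡ take i l ⊎ ∃ λ x → take (suc i) l ≡ take i l ++ [ x ]
take-suc-view zero    []      = inj₁ refl
take-suc-view (suc i) []      = inj₁ refl
take-suc-view zero    (x ∷ l) = inj₂ (x , refl)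
take-suc-view (suc i) (y ∷ l) with take-suc-view i l
... | inj₁ eq       = inj₁ (cong (y ∷_) eq)
... | inj₂ (x , eq) = inj₂ (x , cong (y ∷_) eq)

take-≤-++ : ∀ {X : Set} {i t} → i ≤ t → ∀ (l : List X) → ∃ λ r → take t l ≡ take i l ++ r
take-≤-++ {t = t} z≤n l = take t l , refl
take-≤-++ (s≤s le) [] = [] , refl
take-≤-++ (s≤s le) (x ∷ l) with take-≤-++ le l
... | r , eq = r , cong (x ∷_) eq

take-length-++ : ∀ {X : Set} (u v : List X) → take (length u) (u ++ v) ≡ u
take-length-++ []      v = refl
take-length-++ (x ∷ u) v = cong (x ∷_) (take-length-++ u v)

setOf-∷ʳ : ∀ {k} (xs : List (Fin k)) y → setOf (xs ++ [ y ]) ≡ setOf xs ∪ ⁅ y ⁆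
setOf-∷ʳ []       y = ∪-comm ⁅ y ⁆ ⊥
setOf-∷ʳ (x ∷ xs) y = trans (cong (⁅ x ⁆ ∪_) (setOf-∷ʳ xs y)) (sym (∪-assoc ⁅ x ⁆ (setOf xs) ⁅ y ⁆))

≤ᵇ-true : ∀ i j → (i ≤ᵇ j) ≡ true → i ≤ j
≤ᵇ-true i j eq = ≤ᵇ⇒≤ i j (Equivalence.from T-≡ eq)

true-≤ᵇ : ∀ {i j} → i ≤ j → (i ≤ᵇ j) ≡ true
true-≤ᵇ le = Equivalence.to T-≡ (≤⇒≤ᵇ le)

false-≤ᵇ : ∀ i j → (i ≤ᵇ j) ≡ false → j < i
false-≤ᵇ i j eq = ≰⇒> λ le → case (trans (sym eq) (true-≤ᵇ le))
  where
  case : ¬ (false ≡ true)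
  case ()

-- The action of Sym(E) on the cone, and ranks along words

module _ {n : ℕ} (m : ℕ) where

  open Cone n m

  kindMap : (Fin n → Fin n) → Kind n m → Kind n m
  kindMap f tip       = tip
  kindMap f (base e)  = base (f e)
  kindMap f (tee e j) = tee (f e) j

  -- For a permutation `f` of E this is its action on E(Q), which fixes the tip.
  extend : (Fin n → Fin n) → Fin (suc (n + n * m)) → Fin (suc (n + n * m))
  extend f x = encode (kindMap f (decode m x))

  extend-injective : ∀ {f} → (∀ {x y} → f x ≡ f y → x ≡ y) → ∀ {x y} → extend f x ≡ extend f y → x ≡ y
  extend-injective {f} inj eq = decode-injective (kindMap-injective (encode-injective eq))
    where
    kindMap-injective : ∀ {κ μ} → kindMap f κ ≡ kindMap f μ → κ ≡ μ
    kindMap-injective {tip} {tip} _ = refl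
    kindMap-injective {base d} {base e} eq with f d in fd | f e in fe
    kindMap-injective {base d} {base e} refl | _ | _ = cong base (inj (trans fd (sym fe)))
    kindMap-injective {tee d i} {tee e j} eq with f d in fd | f e in fe
    kindMap-injective {tee d i} {tee e j} refl | _ | _ = cong (λ e → tee e i) (inj (trans fd (sym fe)))

  bases-extend : ∀ f l → bases (map (extend f) l) ≡ map f (bases l)
  bases-extend f = mapMaybe-map-commute _ _ f λ x → trans (cong baseOf (decode-encode _)) (go (decode m x))
    where
    go : ∀ κ → baseOf (kindMap f κ) ≡ Maybe.map f (baseOf κ)
    go tip       = refl
    go (base e)  = refl
    go (tee e j) = refl

  supports-extend : ∀ f l → supports (map (extend f) l) ≡ map f (supports l)
  supports-extend f = mapMaybe-map-commute _ _ f λ x → trans (cong supportOf (decode-encode _)) (go (decode m x))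
    where
    go : ∀ κ → supportOf (kindMap f κ) ≡ Maybe.map f (supportOf κ)
    go tip       = refl
    go (base e)  = refl
    go (tee e j) = refl

  length-extras-extend : ∀ f l → length (extras (map (extend f) l)) ≡ length (extras l)
  length-extras-extend f l = trans (count-map (isExtra ∘ decode m) (extend f) l)
    (count-cong l λ {x} _ → trans (cong isExtra (decode-encode _)) (go (decode m x)))
    where
    go : ∀ κ → isExtra (kindMap f κ) ≡ isExtra κ
    go tip       = refl
    go (base e)  = refl
    go (tee e j) = refl

  bases⊆supports : ∀ l {e} → e ∈ₗ bases l → e ∈ₗ supports l
  bases⊆supports l e∈ with ∈-mapMaybe⁻ (baseOf ∘ decode m) l e∈
  ... | x , x∈ , bx = ∈-mapMaybe⁺ (supportOf ∘ decode m) x∈ (cong supportOf (baseOf⁻ bx))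

  -- By rank-cone, the rank in the cone of the σ-image of the first i entries of l is
  -- freeRank σ i ⊓ suc (supportRank σ i).
  module Word (M : Matroid n) (l : List (Fin (suc (n + n * m)))) (σ : Vec (Fin n) n) where

    private
      f = lookup σ
      a p : List (Fin (suc (n + n * m))) → ℕ
      a u = rank M (setOf (map f (bases u))) + length (extras u)
      p u = rank M (setOf (map f (supports u)))

    freeRank supportRank : ℕ → ℕ
    freeRank    i = a (take i l)
    supportRank i = p (take i l)

    private
      append-just : ∀ (g : Fin (suc (n + n * m)) → Maybe (Fin n)) u {x e} → g x ≡ just e →
        setOf (map f (mapMaybe g (u ++ [ x ]))) ≡ setOf (map f (mapMaybe g u)) ∪ ⁅ f e ⁆
      append-just g u {x} {e} eq = begin
        setOf (map f (mapMaybe g (u ++ [ x ])))           ≡⟨ cong (setOf ∘ map f) (mapMaybe-++ g u [ x ]) ⟩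
        setOf (map f (mapMaybe g u ++ mapMaybe g [ x ]))  ≡⟨ cong (λ z → setOf (map f (mapMaybe g u ++ List.catMaybes [ z ]))) eq ⟩
        setOf (map f (mapMaybe g u ++ [ e ]))             ≡⟨ cong setOf (map-++ f (mapMaybe g u) [ e ]) ⟩
        setOf (map f (mapMaybe g u) ++ [ f e ])           ≡⟨ setOf-∷ʳ (map f (mapMaybe g u)) (f e) ⟩
        setOf (map f (mapMaybe g u)) ∪ ⁅ f e ⁆            ∎
        where open ≡-Reasoning

      append-nothing : ∀ (g : Fin (suc (n + n * m)) → Maybe (Fin n)) u {x} → g x ≡ nothing →
        setOf (map f (mapMaybe g (u ++ [ x ]))) ≡ setOf (map f (mapMaybe g u))
      append-nothing g u {x} eq = cong (setOf ∘ map f) (trans (mapMaybe-++ g u [ x ])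
        (trans (cong (λ z → mapMaybe g u ++ List.catMaybes [ z ]) eq) (++-identityʳ _)))

      append-extra : ∀ u {x} → isExtra (decode m x) ≡ true → length (extras (u ++ [ x ])) ≡ suc (length (extras u))
      append-extra u {x} eq = trans (cong length (filter-++ (T? ∘ isExtra ∘ decode m) u [ x ]))
        (trans (length-++ (extras u)) (trans (cong (length (extras u) +_) single) (+-comm _ 1)))
        where
        single : length (extras [ x ]) ≡ 1
        single rewrite eq = refl

      append-base : ∀ u {x} → isExtra (decode m x) ≡ false → length (extras (u ++ [ x ])) ≡ length (extras u)
      append-base u {x} eq = trans (cong length (filter-++ (T? ∘ isExtra ∘ decode m) u [ x ]))
        (trans (length-++ (extras u)) (trans (cong (length (extras u) +_) none) (+-identityʳ _)))
        where
        none : length (extras [ x ]) ≡ 0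
        none rewrite eq = refl

      -- The difference of `a` and `p` never decreases when an entry is appended. The tip raises
      -- only `a`; an element of E raises `p` by no more than `a` because X_E ⊆ supp X; an element
      -- of T_e raises `a` by one and `p` by at most one.
      p-step≤a-step : ∀ u x → p (u ++ [ x ]) + a u ≤ a (u ++ [ x ]) + p u
      p-step≤a-step u x = go (decode m x) refl
        where
        open ≤-Reasoning
        B = setOf (map f (bases u))
        P = setOf (map f (supports u))
        k = length (extras u)
        B⊆P : B ⊆ P
        B⊆P e∈ = ∈-setOf⁺ (map-⊆ (bases⊆supports u) (∈-setOf⁻ _ e∈))
        arith₁ : ∀ p b k → p + (b + k) + 1 ≡ b + suc k + p
        arith₁ = solve-∀
        arith₂ : ∀ p b k → suc p + (b + k) ≡ b + suc k + p
        arith₂ = solve-∀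
        arith₃ : ∀ p b k → p + (b + k) ≡ p + b + k
        arith₃ = solve-∀
        arith₄ : ∀ p b k → b + p + k ≡ b + k + p
        arith₄ = solve-∀
        go : ∀ κ → decode m x ≡ κ → p (u ++ [ x ]) + a u ≤ a (u ++ [ x ]) + p u
        go tip dx = begin
          p (u ++ [ x ]) + a u                     ≡⟨ cong (λ Z → rank M Z + a u) (append-nothing _ u (cong supportOf dx)) ⟩
          rank M P + (rank M B + k)                ≤⟨ m≤m+n _ 1 ⟩
          rank M P + (rank M B + k) + 1            ≡⟨ arith₁ (rank M P) (rank M B) k ⟩
          rank M B + suc k + rank M P              ≡⟨ cong₂ (λ Z k → rank M Z + k + rank M P)
                                                        (sym (append-nothing _ u (cong baseOf dx))) (sym (append-extra u (cong isExtra dx))) ⟩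
          a (u ++ [ x ]) + p u                     ∎
        go (base e) dx = begin
          p (u ++ [ x ]) + a u                     ≡⟨ cong (λ Z → rank M Z + a u) (append-just _ u (cong supportOf dx)) ⟩
          rank M (P ∪ ⁅ f e ⁆) + (rank M B + k)    ≡⟨ arith₃ (rank M (P ∪ ⁅ f e ⁆)) (rank M B) k ⟩
          rank M (P ∪ ⁅ f e ⁆) + rank M B + k      ≤⟨ +-monoˡ-≤ k (rank-diminishing M ⁅ f e ⁆ B⊆P) ⟩
          rank M (B ∪ ⁅ f e ⁆) + rank M P + k      ≡⟨ arith₄ (rank M P) (rank M (B ∪ ⁅ f e ⁆)) k ⟩
          rank M (B ∪ ⁅ f e ⁆) + k + rank M P      ≡⟨ cong₂ (λ Z k → rank M Z + k + rank M P)
                                                        (sym (append-just _ u (cong baseOf dx))) (sym (append-base u (cong isExtra dx))) ⟩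
          a (u ++ [ x ]) + p u                     ∎
        go (tee e j) dx = begin
          p (u ++ [ x ]) + a u                     ≡⟨ cong (λ Z → rank M Z + a u) (append-just _ u (cong supportOf dx)) ⟩
          rank M (P ∪ ⁅ f e ⁆) + (rank M B + k)    ≤⟨ +-monoˡ-≤ (rank M B + k) (rank-∪⁅⁆≤ M P (f e)) ⟩
          suc (rank M P) + (rank M B + k)          ≡⟨ arith₂ (rank M P) (rank M B) k ⟩
          rank M B + suc k + rank M P              ≡⟨ cong₂ (λ Z k → rank M Z + k + rank M P)
                                                        (sym (append-nothing _ u (cong baseOf dx))) (sym (append-extra u (cong isExtra dx))) ⟩
          a (u ++ [ x ]) + p u                     ∎

      step : ∀ i → supportRank (suc i) + freeRank i ≤ freeRank (suc i) + supportRank i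
      step i with take-suc-view i l
      ... | inj₁ eq       rewrite eq = ≤-reflexive (+-comm (p (take i l)) (a (take i l)))
      ... | inj₂ (x , eq) rewrite eq = p-step≤a-step (take i l) x

    -- Both ranks vanish on the empty prefix, and by `step` their difference never decreases.
    supportRank≤freeRank : ∀ i → supportRank i ≤ freeRank i
    supportRank≤freeRank zero    = m≤m+n (rank M ⊥) 0
    supportRank≤freeRank (suc i) = +-cancelʳ-≤ (freeRank i) _ _
      (≤-trans (step i) (+-monoʳ-≤ (freeRank (suc i)) (supportRank≤freeRank i)))

    -- A nonnegative difference that never decreases and vanishes at `t` has vanished at all earlier
    -- times.
    tight-down : ∀ i t → i ≤ t → freeRank t ≤ supportRank t → freeRank i ≤ supportRank i
    tight-down i t i≤t tight with m≤n⇒m<n∨m≡n i≤t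
    ... | inj₂ refl = tight
    tight-down i (suc t) i≤t tight | inj₁ (s≤s i≤t′) = tight-down i t i≤t′
      (+-cancelˡ-≤ (supportRank (suc t)) _ _ (≤-trans (step t) (+-monoˡ-≤ (supportRank t) tight)))

    tight-≡ : ∀ i t → i ≤ t → freeRank t ≤ supportRank t → freeRank i ≡ supportRank i
    tight-≡ i t i≤t tight = ≤-antisym (tight-down i t i≤t tight) (supportRank≤freeRank i)

    -- By `supportRank≤freeRank` this tests for equality.
    tight : ℕ → Bool
    tight t = freeRank t ≤ᵇ supportRank t

    coneRank : ℕ → ℕ
    coneRank i = freeRank i ⊓ suc (supportRank i)

    -- A word is tight at exactly the times before its span acquires the tip.
    coneRank-tight : ∀ i t → i ≤ t → freeRank t ≤ supportRank t → coneRank i ≡ supportRank i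
    coneRank-tight i t i≤t le = trans (cong (_⊓ suc (supportRank i)) (tight-≡ i t i≤t le)) (m≤n⇒m⊓n≡m (n≤1+n _))

    coneRank-¬tight : ∀ i t → t ≤ i → supportRank t < freeRank t → coneRank i ≡ suc (supportRank i)
    coneRank-¬tight i t t≤i lt = m≥n⇒m⊓n≡n (≰⇒> λ le → <⇒≱ lt (tight-down t i t≤i le))

  -- Cone ranks along a fixed word have the same distribution for M and N

  module _ (M N : Matroid n) (same : SameG M N) (l : List (Fin (suc (n + n * m)))) where

    open Word using (freeRank; supportRank; tight; coneRank)

    private
      Extensional : ((ℕ → ℕ) → Bool) → Set
      Extensional R = ∀ {f g} → (∀ i → f i ≡ g i) → R f ≡ R g

    -- While the word is tight, supportRank can be replaced by freeRank; up to time t this involves only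
    -- bases, whence all sets involved are prefixes of bases (take t l) ++ supports l.
    sameG-tight : ∀ t (R : (ℕ → ℕ) → Bool) → Extensional R →
      count (λ σ → tight M l σ t ∧ R (supportRank M l σ)) (perms n)
      ≡ count (λ σ → tight N l σ t ∧ R (supportRank N l σ)) (perms n)
    sameG-tight t R ext = trans (viaPrefix M) (trans (sameG-prefixRank M N same Φ Φ-ext w) (sym (viaPrefix N)))
      where
      bt = bases (take t l)
      w = bt ++ supports l
      -- Positions in `w`: the prefix of length `b i` is `bases (take i l)` if `i ≤ t`, and the
      -- prefix of length `s i` has the same elements as `supports (take i l)` if `t ≤ i`.
      b s : ℕ → ℕ
      b i = length (bases (take i l))
      s i = length bt + length (supports (take i l))
      spliced : (ℕ → ℕ) → ℕ → ℕ
      spliced g i = if i ≤ᵇ t then g (b i) + length (extras (take i l)) else g (s i)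
      Φ : (ℕ → ℕ) → Bool
      -- The first conjunct is tightness at `t`, read off from the chain.
      Φ g = (g (b t) + length (extras (take t l)) ≤ᵇ g (s t)) ∧ R (spliced g)
      Φ-ext : Extensional Φ
      Φ-ext {f} {g} eq = cong₂ _∧_
        (cong₂ _≤ᵇ_ (cong (_+ length (extras (take t l))) (eq (b t))) (eq (s t)))
        (ext λ i → cong₂ (if i ≤ᵇ t then_else_) (cong (_+ length (extras (take i l))) (eq (b i))) (eq (s i)))
      viaPrefix : ∀ L → count (λ σ → tight L l σ t ∧ R (supportRank L l σ)) (perms n)
                      ≡ count (Φ ∘ prefixRank L w) (perms n)
      viaPrefix L = count-cong (perms n) λ {σ} _ → pointwise σ
        where
        pointwise : ∀ σ → (tight L l σ t ∧ R (supportRank L l σ)) ≡ Φ (prefixRank L w σ)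
        pointwise σ = trans conj (cong (_∧ R (spliced g)) (sym (cong₂ (λ x y → x + length (extras (take t l)) ≤ᵇ y) (prefix-bases ≤-refl) (prefix-supports ≤-refl))))
          where
          g = prefixRank L w σ
          prefix-bases : ∀ {i} → i ≤ t → g (b i) ≡ rank L (setOf (map (lookup σ) (bases (take i l))))
          prefix-bases {i} i≤t with take-≤-++ i≤t l
          ... | r , eq = cong (rank L ∘ setOf ∘ map (lookup σ)) (begin
            take (b i) w                                       ≡⟨ cong (λ z → take (b i) (bases z ++ supports l)) eq ⟩
            take (b i) (bases (take i l ++ r) ++ supports l)   ≡⟨ cong (λ z → take (b i) (z ++ supports l)) (mapMaybe-++ _ (take i l) r) ⟩
            take (b i) ((bases (take i l) ++ bases r) ++ supports l) ≡⟨ cong (take (b i)) (++-assoc (bases (take i l)) _ _) ⟩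
            take (b i) (bases (take i l) ++ (bases r ++ supports l)) ≡⟨ take-length-++ (bases (take i l)) _ ⟩
            bases (take i l)                                   ∎)
            where open ≡-Reasoning
          prefix-supports : ∀ {i} → t ≤ i → g (s i) ≡ supportRank L l σ i
          prefix-supports {i} t≤i = cong (rank L) (trans
            (cong (setOf ∘ map (lookup σ)) prefix)
            (setOf-cong (map-⊆ ([ bt⊆ , id ]′ ∘ ∈-++⁻ bt)) (map-⊆ (∈-++⁺ʳ bt))))
            where
            prefix : take (s i) w ≡ bt ++ supports (take i l)
            prefix = begin
              take (s i) w                                                   ≡⟨ cong (λ z → take (s i) (bt ++ supports z)) (sym (take++drop≡id i l)) ⟩
              take (s i) (bt ++ supports (take i l ++ drop i l))             ≡⟨ cong (λ z → take (s i) (bt ++ z)) (mapMaybe-++ _ (take i l) (drop i l)) ⟩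
              take (s i) (bt ++ (supports (take i l) ++ supports (drop i l))) ≡⟨ cong (take (s i)) (sym (++-assoc bt _ _)) ⟩
              take (s i) ((bt ++ supports (take i l)) ++ supports (drop i l)) ≡⟨ cong (λ z → take z ((bt ++ supports (take i l)) ++ supports (drop i l))) (sym (length-++ bt)) ⟩
              take (length (bt ++ supports (take i l))) ((bt ++ supports (take i l)) ++ supports (drop i l)) ≡⟨ take-length-++ (bt ++ supports (take i l)) _ ⟩
              bt ++ supports (take i l)                                      ∎
              where open ≡-Reasoning
            bt⊆ : ∀ {e} → e ∈ₗ bt → e ∈ₗ supports (take i l)
            bt⊆ e∈ with take-≤-++ t≤i l
            ... | r , eq = subst (λ z → _ ∈ₗ supports z) (sym eq) (subst (_ ∈ₗ_) (sym (mapMaybe-++ _ (take t l) r))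
                             (∈-++⁺ˡ (bases⊆supports (take t l) e∈)))
          -- `spliced g` agrees with the support ranks only under tightness at `t`; otherwise both
          -- conjunctions are false.
          conj : (tight L l σ t ∧ R (supportRank L l σ)) ≡ (tight L l σ t ∧ R (spliced g))
          conj with tight L l σ t in eq
          ... | false = refl
          ... | true  = ext λ i → sym (spliced≡ i)
            where
            spliced≡ : ∀ i → spliced g i ≡ supportRank L l σ i
            spliced≡ i with i ≤ᵇ t in i≤t
            ... | true  = trans (cong (_+ length (extras (take i l))) (prefix-bases (≤ᵇ-true i t i≤t)))
                                (Word.tight-≡ L l σ i t (≤ᵇ-true i t i≤t) (≤ᵇ-true _ _ eq))
            ... | false = prefix-supports (<⇒≤ (false-≤ᵇ i t i≤t))

    module _ (K : ℕ) (s : List ℕ) where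

      private
        R : (ℕ → ℕ) → Bool
        R f = does (≡-dec _≟_ (differences f K) s)

        R-cong : ∀ {f g} → (∀ i → i ≤ K → f i ≡ g i) → R f ≡ R g
        R-cong eq = cong (λ d → does (≡-dec _≟_ d s)) (differences-cong K eq)

        -- The shape of the cone rank when `t` is the last tight time: from the next time on, the
        -- tip adds one to the support rank.
        jump : ℕ → (ℕ → ℕ) → ℕ → ℕ
        jump t f i = if i ≤ᵇ t then f i else suc (f i)

        R-jump-ext : ∀ t → Extensional (R ∘ jump t)
        R-jump-ext t eq = R-cong λ i _ → cong (λ z → if i ≤ᵇ t then z else suc z) (eq i)

        module _ (L : Matroid n) where

          -- `good¬tight t` counts the good σ whose last tight time is `t`. Unlike the other two
          -- counts, `jumpTight t` involves support ranks alone, so that `sameG-tight` applies to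
          -- it.
          goodTight good¬tight jumpTight : ℕ → ℕ
          goodTight t  = count (λ σ → tight L l σ t ∧ R (coneRank L l σ)) (perms n)
          jumpTight t  = count (λ σ → tight L l σ t ∧ R (jump t (supportRank L l σ))) (perms n)
          good¬tight t = count (λ σ → not (tight L l σ (suc t)) ∧ (tight L l σ t ∧ R (coneRank L l σ))) (perms n)

          tight-pred : ∀ {σ t} → tight L l σ (suc t) ≡ true → tight L l σ t ≡ true
          tight-pred {σ} {t} eq = true-≤ᵇ (Word.tight-down L l σ t (suc t) (n≤1+n t) (≤ᵇ-true _ _ eq))

          goodTight-suc : ∀ t → goodTight t ≡ goodTight (suc t) + good¬tight t
          goodTight-suc t = trans (count-split _ (λ σ → tight L l σ (suc t)) (perms n))
            (cong (_+ good¬tight t) (count-cong (perms n) λ {σ} _ → merge σ))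
            where
            merge : ∀ σ → (tight L l σ (suc t) ∧ (tight L l σ t ∧ R (coneRank L l σ)))
                        ≡ (tight L l σ (suc t) ∧ R (coneRank L l σ))
            merge σ with tight L l σ (suc t) in eq
            ... | false = refl
            ... | true rewrite tight-pred {σ} {t} eq = refl

          -- Split by tightness at `suc t`. If it fails while `t` is tight, the jump at `t` is the
          -- true cone rank, so the second summand counts exactly the good σ with last tight time
          -- `t`.
          jumpTight-suc : ∀ t → jumpTight t
            ≡ count (λ σ → tight L l σ (suc t) ∧ R (jump t (supportRank L l σ))) (perms n) + good¬tight t
          jumpTight-suc t = trans (count-split _ (λ σ → tight L l σ (suc t)) (perms n))
            (cong₂ _+_ (count-cong (perms n) λ {σ} _ → merge σ) (count-cong (perms n) λ {σ} _ → at-jump σ))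
            where
            merge : ∀ σ → (tight L l σ (suc t) ∧ (tight L l σ t ∧ R (jump t (supportRank L l σ))))
                        ≡ (tight L l σ (suc t) ∧ R (jump t (supportRank L l σ)))
            merge σ with tight L l σ (suc t) in eq
            ... | false = refl
            ... | true rewrite tight-pred {σ} {t} eq = refl
            at-jump : ∀ σ → (not (tight L l σ (suc t)) ∧ (tight L l σ t ∧ R (jump t (supportRank L l σ))))
                          ≡ (not (tight L l σ (suc t)) ∧ (tight L l σ t ∧ R (coneRank L l σ)))
            at-jump σ with tight L l σ (suc t) in eq | tight L l σ t in eq′
            ... | true  | _     = refl
            ... | false | false = refl
            ... | false | true  = R-cong λ i _ → jump≡ i
              where
              jump≡ : ∀ i → jump t (supportRank L l σ) i ≡ coneRank L l σ i
              jump≡ i with i ≤ᵇ t in i≤t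
              ... | true  = sym (Word.coneRank-tight L l σ i t (≤ᵇ-true i t i≤t) (≤ᵇ-true _ _ eq′))
              ... | false = sym (Word.coneRank-¬tight L l σ i (suc t) (false-≤ᵇ i t i≤t) (false-≤ᵇ _ _ eq))

          goodTight-K : goodTight K ≡ count (λ σ → tight L l σ K ∧ R (supportRank L l σ)) (perms n)
          goodTight-K = count-cong (perms n) λ {σ} _ → pointwise σ
            where
            pointwise : ∀ σ → (tight L l σ K ∧ R (coneRank L l σ)) ≡ (tight L l σ K ∧ R (supportRank L l σ))
            pointwise σ with tight L l σ K in eq
            ... | false = refl
            ... | true  = R-cong λ i i≤K → Word.coneRank-tight L l σ i K i≤K (≤ᵇ-true _ _ eq)

          -- The empty prefix is always tight.
          goodTight-0 : goodTight 0 ≡ count (λ σ → R (coneRank L l σ)) (perms n)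
          goodTight-0 = count-cong (perms n) λ {σ} _ →
            cong (_∧ R (coneRank L l σ)) (true-≤ᵇ (≤-reflexive (+-identityʳ (rank L ⊥))))

        -- In `jumpTight-suc` the other two terms are counts to which `sameG-tight` applies, at
        -- times `t` and `suc t` with the same jump; cancelling leaves this one.
        good¬tight-same : ∀ t → good¬tight M t ≡ good¬tight N t
        good¬tight-same t = +-cancelˡ-≡ (count (λ σ → tight M l σ (suc t) ∧ R (jump t (supportRank M l σ))) (perms n)) _ _
          (begin
            _                 ≡⟨ sym (jumpTight-suc M t) ⟩
            jumpTight M t     ≡⟨ sameG-tight t (R ∘ jump t) (R-jump-ext t) ⟩
            jumpTight N t     ≡⟨ jumpTight-suc N t ⟩
            _                 ≡⟨ cong (_+ good¬tight N t) (sym (sameG-tight (suc t) (R ∘ jump t) (R-jump-ext t))) ⟩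
            _                 ∎)
          where open ≡-Reasoning

        -- Induction downwards from time `K`, where the cone rank is the support rank throughout;
        -- each step back adds one `good¬tight`.
        goodTight-same : ∀ d t → d + t ≡ K → goodTight M t ≡ goodTight N t
        goodTight-same zero t refl = trans (goodTight-K M)
          (trans (sameG-tight K R (λ eq → R-cong λ i _ → eq i)) (sym (goodTight-K N)))
        goodTight-same (suc d) t eq = trans (goodTight-suc M t)
          (trans (cong₂ _+_ (goodTight-same d (suc t) (trans (+-suc d t) eq)) (good¬tight-same t)) (sym (goodTight-suc N t)))

      sameG-coneRank : count (λ σ → R (coneRank M l σ)) (perms n) ≡ count (λ σ → R (coneRank N l σ)) (perms n)
      sameG-coneRank = trans (sym (goodTight-0 M)) (trans (goodTight-same K 0 (+-identityʳ K)) (goodTight-0 N))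

  -- Averaging over Sym(E)

  private
    K : ℕ
    K = suc (n + n * m)
    is : List ℕ → List ℕ → Bool
    is s t = does (≡-dec _≟_ t s)

  -- For each σ, composition with its action on E(Q) permutes `perms K`, so the coefficient may be
  -- counted through σπ. Summing over σ and exchanging the order leaves, for each fixed π, a count
  -- over σ.
  Gcoeff-cone : ∀ (M : Matroid n) Q → IsFreeCone M m Q → ∀ s → length (perms n) * Gcoeff Q s
    ≡ sumOver (λ π → count (λ σ → is s (differences (Word.coneRank M (toList π) σ) K)) (perms n)) (perms K)
  Gcoeff-cone M Q cone s = begin
    length (perms n) * Gcoeff Q s
      ≡⟨ cong (length (perms n) *_) (Gcoeff≡count Q s) ⟩
    length (perms n) * count (is s ∘ rankSeq Q) (perms K)
      ≡⟨ sym (sumOver-const _ (perms n)) ⟩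
    sumOver (λ σ → count (is s ∘ rankSeq Q) (perms K)) (perms n)
      ≡⟨ sumOver-cong (perms n) (λ σ∈ → sym (reindex σ∈)) ⟩
    sumOver (λ σ → count (λ π → is s (rankSeq Q (Vec.map (extend (lookup σ)) π))) (perms K)) (perms n)
      ≡⟨ sumOver-count-swap (λ σ π → is s (rankSeq Q (Vec.map (extend (lookup σ)) π))) (perms n) (perms K) ⟩
    sumOver (λ π → count (λ σ → is s (rankSeq Q (Vec.map (extend (lookup σ)) π))) (perms n)) (perms K)
      ≡⟨ sumOver-cong (perms K) (λ π∈ → count-cong (perms n) (λ σ∈ → cong (is s) (ranks π∈ σ∈))) ⟩
    sumOver (λ π → count (λ σ → is s (differences (Word.coneRank M (toList π) σ) K)) (perms n)) (perms K) ∎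
    where
    open ≡-Reasoning
    ext-inj : ∀ {σ} → σ ∈ₗ perms n → ∀ {x y} → extend (lookup σ) x ≡ extend (lookup σ) y → x ≡ y
    ext-inj σ∈ = extend-injective (lookup-injective (∈-perms⁻ σ∈))
    reindex : ∀ {σ} → σ ∈ₗ perms n →
      count (λ π → is s (rankSeq Q (Vec.map (extend (lookup σ)) π))) (perms K) ≡ count (is s ∘ rankSeq Q) (perms K)
    reindex σ∈ = count-reindex (is s ∘ rankSeq Q) _ perms-unique
      (map-injective (ext-inj σ∈)) (map-∈-perms (ext-inj σ∈))
      where
      map-injective : ∀ {f : Fin K → Fin K} → (∀ {x y} → f x ≡ f y → x ≡ y) →
        ∀ {l} {u v : Vec (Fin K) l} → Vec.map f u ≡ Vec.map f v → u ≡ v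
      map-injective inj {u = Vec.[]} {Vec.[]} _ = refl
      map-injective inj {u = x Vec.∷ u} {y Vec.∷ v} eq =
        cong₂ Vec._∷_ (inj (Vecₚ.∷-injectiveˡ eq)) (map-injective inj (Vecₚ.∷-injectiveʳ eq))
    ranks : ∀ {π σ} → π ∈ₗ perms K → σ ∈ₗ perms n →
      rankSeq Q (Vec.map (extend (lookup σ)) π) ≡ differences (Word.coneRank M (toList π) σ) K
    ranks {π} {σ} π∈ σ∈ = trans (rankSeq≡differences Q _) (differences-cong K λ i _ → begin
      rank Q (setOf (take i (toList (Vec.map g π))))
        ≡⟨ cong (λ z → rank Q (setOf (take i z))) (Vecₚ.toList-map g π) ⟩
      rank Q (setOf (take i (map g (toList π))))
        ≡⟨ cong (rank Q ∘ setOf) (take-map i (toList π)) ⟩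
      rank Q (setOf (map g (take i (toList π))))
        ≡⟨ rank-cone M m Q cone _ (Uniq.map⁺ (ext-inj σ∈) (Uniq.take⁺ i (∈-perms⁻ π∈))) ⟩
      _
        ≡⟨ cong₂ (λ x y → x ⊓ suc y)
             (cong₂ _+_ (cong (rank M ∘ setOf) (bases-extend (lookup σ) (take i (toList π)))) (length-extras-extend (lookup σ) (take i (toList π))))
             (cong (rank M ∘ setOf) (supports-extend (lookup σ) (take i (toList π)))) ⟩
      Word.coneRank M (toList π) σ i ∎)
      where g = extend (lookup σ)

  -- The sums of `Gcoeff-cone` agree term by term in π, and the common factor, the number of
  -- permutations of E, is nonzero.
  sameG-cone : ∀ (M N : Matroid n) → SameG M N → ∀ Q Q′ → IsFreeCone M m Q → IsFreeCone N m Q′ → SameG Q Q′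
  sameG-cone M N same Q Q′ cone cone′ s = *-cancelˡ-≡ _ _ (length (perms n)) {{nonempty}} (begin
    length (perms n) * Gcoeff Q s    ≡⟨ Gcoeff-cone M Q cone s ⟩
    total M                          ≡⟨ sumOver-cong (perms K) (λ {π} _ → sameG-coneRank M N same (toList π) K s) ⟩
    total N                          ≡⟨ sym (Gcoeff-cone N Q′ cone′ s) ⟩
    length (perms n) * Gcoeff Q′ s   ∎)
    where
    open ≡-Reasoning
    total : Matroid n → ℕ
    total L = sumOver (λ π → count (λ σ → is s (differences (Word.coneRank L (toList π) σ) K)) (perms n)) (perms K)
    nonempty : NonZero (length (perms n))
    nonempty = >-nonZero (∈-length (proj₂ (perms-nonempty {n})))

-- Gluing injections between the blocks of two partitions

lookup-unique : ∀ {A : Set} {xs : List A} → Unique xs → ∀ {i j} → List.lookup xs i ≡ List.lookup xs j → i ≡ j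
lookup-unique {xs = x ∷ xs} _ {zero} {zero} _ = refl
lookup-unique {xs = x ∷ xs} (x∉ ∷ _) {zero}  {suc j} eq = ⊥-elim (All.lookup x∉ (∈-lookup j) eq)
lookup-unique {xs = x ∷ xs} (x∉ ∷ _) {suc i} {zero}  eq = ⊥-elim (All.lookup x∉ (∈-lookup i) (sym eq))
lookup-unique {xs = x ∷ xs} (_ ∷ u)  {suc i} {suc j} eq = cong suc (lookup-unique u eq)

-- Positions in the two lists have different types, so they are compared as natural numbers.
lookup-elements-injective : ∀ {k} {S T : Subset k} → S ≡ T →
  ∀ (i : Fin (length (elements S))) (j : Fin (length (elements T))) →
  List.lookup (elements S) i ≡ List.lookup (elements T) j → toℕ i ≡ toℕ j
lookup-elements-injective {S = S} refl i j eq = cong toℕ (lookup-unique (elements-unique S) eq)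

lookup-elements-cong : ∀ {k} {S T : Subset k} → S ≡ T →
  ∀ (i : Fin (length (elements S))) (j : Fin (length (elements T))) →
  toℕ i ≡ toℕ j → List.lookup (elements S) i ≡ List.lookup (elements T) j
lookup-elements-cong {S = S} refl i j eq = cong (List.lookup (elements S)) (toℕ-injective eq)

module Glue {k k′ : ℕ} (c : Fin k → Subset k) (d : Fin k → Subset k′)
  (∈c : ∀ x → x ∈ c x)
  (d-meet : ∀ x y {z} → z ∈ d x → z ∈ d y → c x ≡ c y)
  (d-cong : ∀ x y → c x ≡ c y → d x ≡ d y)
  (c≤d : ∀ x → ∣ c x ∣ ≤ ∣ d x ∣) where

  private
    len≤ : ∀ x → length (elements (c x)) ≤ length (elements (d x))
    len≤ x = subst₂ _≤_ (sym (length-elements (c x))) (sym (length-elements (d x))) (c≤d x)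

    pos : ∀ x → Fin (length (elements (c x)))
    pos x = index (∈-elements⁺ (∈c x))

    lookup-pos : ∀ x → x ≡ List.lookup (elements (c x)) (pos x)
    lookup-pos x = lookup-index (∈-elements⁺ (∈c x))

  -- The position of `x` in its block `c x` is kept in the target block `d x`, which is at least as
  -- long.
  glue : Fin k → Fin k′
  glue x = List.lookup (elements (d x)) (inject≤ (pos x) (len≤ x))

  glue-∈ : ∀ x → glue x ∈ d x
  glue-∈ x = ∈-elements⁻ (∈-lookup (inject≤ (pos x) (len≤ x)))

  -- Equal values lie in two target blocks that meet, so the source blocks agree by `d-meet`; then
  -- the positions agree as well.
  glue-injective : ∀ {x y} → glue x ≡ glue y → x ≡ y
  glue-injective {x} {y} eq = trans (lookup-pos x) (trans (lookup-elements-cong cx≡cy (pos x) (pos y) pos≡) (sym (lookup-pos y)))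
    where
    cx≡cy : c x ≡ c y
    cx≡cy = d-meet x y (glue-∈ x) (subst (_∈ d y) (sym eq) (glue-∈ y))
    pos≡ : toℕ (pos x) ≡ toℕ (pos y)
    pos≡ = trans (sym (toℕ-inject≤ (pos x) (len≤ x)))
      (trans (lookup-elements-injective (d-cong x y cx≡cy) _ _ eq) (toℕ-inject≤ (pos y) (len≤ y)))

  glue-misses : ∀ x → ∣ c x ∣ < ∣ d x ∣ → ∃ λ z → ∀ y → glue y ≢ z
  glue-misses x lt = z , misses
    where
    lt′ : length (elements (c x)) < length (elements (d x))
    lt′ = subst₂ _<_ (sym (length-elements (c x))) (sym (length-elements (d x))) lt
    -- Elements of `c x` occupy the positions below its size, so this position is the first free
    -- one.
    z = List.lookup (elements (d x)) (fromℕ< lt′)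
    misses : ∀ y → glue y ≢ z
    misses y eq = <-irrefl pos≡ (toℕ<n (pos y))
      where
      cy≡cx : c y ≡ c x
      cy≡cx = d-meet y x (glue-∈ y) (subst (_∈ d x) (sym eq) (∈-elements⁻ (∈-lookup (fromℕ< lt′))))
      pos≡ : toℕ (pos y) ≡ length (elements (c y))
      pos≡ = trans (sym (toℕ-inject≤ (pos y) (len≤ y)))
        (trans (lookup-elements-injective (d-cong y x cy≡cx) _ (fromℕ< lt′) eq)
          (trans (toℕ-fromℕ< lt′) (cong (length ∘ elements) (sym cy≡cx))))

-- Preimages and isomorphisms

injective⇒surjective : ∀ {k} {g : Fin k → Fin k} → (∀ {x y} → g x ≡ g y → x ≡ y) → ∀ z → ∃ λ x → g x ≡ z
injective⇒surjective {k} {g} inj z with ∈-map⁻ g (∈-resp-↭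
  (unique-⊆-length⇒↭ (Uniq.map⁺ inj (Uniq.allFin⁺ k)) (λ {x} _ → ∈-allFin x)
    (≤-reflexive (sym (length-map g (allFin k))))) (∈-allFin z))
... | x , _ , eq = x , sym eq

preimage : ∀ {k k′} → (Fin k → Fin k′) → Subset k′ → Subset k
preimage g Y = tabulate λ x → lookup Y (g x)

∈-preimage⁺ : ∀ {k k′} {g : Fin k → Fin k′} {Y x} → g x ∈ Y → x ∈ preimage g Y
∈-preimage⁺ p = ∈-tabulate⁺ ([]=⇒lookup p)

∈-preimage⁻ : ∀ {k k′} {g : Fin k → Fin k′} {Y x} → x ∈ preimage g Y → g x ∈ Y
∈-preimage⁻ {g = g} {Y} {x} p = lookup⇒[]= (g x) Y (∈-tabulate⁻ p)

injection⇒isomorphic : ∀ {k} (M N : Matroid k) (g : Fin k → Fin k) → (∀ {x y} → g x ≡ g y → x ≡ y) →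
  (∀ Y → rank N Y ≡ rank M (preimage g Y)) → Isomorphic M N
injection⇒isomorphic M N g inj eq =
  mk↔ₛ′ g (proj₁ ∘ surj) (proj₂ ∘ surj) (λ x → inj (proj₂ (surj (g x)))) , eq
  where surj = injective⇒surjective inj

isomorphic-sym : ∀ {k k′} (M : Matroid k) (N : Matroid k′) → Isomorphic M N → Isomorphic N M
isomorphic-sym M N (σ , eq) = mk↔ₛ′ from to strictlyInverseʳ strictlyInverseˡ
  , λ X → sym (trans (eq (preimage from X)) (cong (rank M)
      (trans (tabulate-cong λ x → trans (lookup∘tabulate (lookup X ∘ from) (to x)) (cong (lookup X) (strictlyInverseʳ x)))
             (tabulate∘lookup X))))
  where open Inverse σ

-- Rank-one flats of a loopless matroid

module Points {n : ℕ} (M : Matroid n) (loopless : Loopless M) where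

  point : Fin n → Subset n
  point e = closure M ⁅ e ⁆

  ∈-point : ∀ e → e ∈ point e
  ∈-point e = ⊆closure M (x∈⁅x⁆ e)

  point-flat : ∀ e → IsFlat M (point e)
  point-flat e = closure-flat M ⁅ e ⁆

  rank-point : ∀ e → rank M (point e) ≡ 1
  rank-point e = trans (rank-closure M ⁅ e ⁆) (loopless e)

  point⊆ : ∀ {F e} → IsFlat M F → e ∈ F → point e ⊆ F
  point⊆ fl e∈F = closure-least M fl (⁅⁆⊆ e∈F)

  point-unique : ∀ {F e} → IsFlat M F → rank M F ≡ 1 → e ∈ F → F ≡ point e
  point-unique {F} {e} fl r e∈F = sym (flat-≡ M (point-flat e) (point⊆ fl e∈F)
    (≤-reflexive (trans r (sym (rank-point e)))))

  point-≡ : ∀ {e f} → f ∈ point e → point e ≡ point f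
  point-≡ {e} f∈ = point-unique (point-flat e) (rank-point e) f∈

  1≤rank : ∀ {X e} → e ∈ X → 1 ≤ rank M X
  1≤rank {X} {e} e∈X = ≤-trans (≤-reflexive (sym (loopless e))) (rank-mono M _ _ (⁅⁆⊆ e∈X))

  2≤rank : ∀ {X e f} → e ∈ X → f ∈ X → f ∉ point e → 2 ≤ rank M X
  2≤rank {X} {e} {f} e∈ f∈ f∉ = ≤-trans
    (≤∧≢⇒< (1≤rank (p⊆p∪q ⁅ f ⁆ (x∈⁅x⁆ e))) (λ eq → f∉ (∈-closure⁺ M (trans (sym eq) (sym (loopless e))))))
    (rank-mono M _ _ (∪-lub (⁅⁆⊆ e∈) (⁅⁆⊆ f∈)))

  nonempty-of-rank : ∀ {X} → 1 ≤ rank M X → ∃ λ e → e ∈ X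
  nonempty-of-rank {X} 1≤r with any? (_∈? X)
  ... | yes p = p
  ... | no ¬p = ⊥-elim (<⇒≱ 1≤r (≤-trans (rank-mono M X ⊥ (λ {e} e∈ → ⊥-elim (¬p (e , e∈)))) (≤-reflexive (rank-⊥ M))))

  -- Both flats equal the closure of `e` and `f`, which already has rank two.
  line-unique : ∀ {F G e f} → IsFlat M F → IsFlat M G → rank M F ≤ 2 → rank M G ≤ 2 →
                e ∈ F → f ∈ F → e ∈ G → f ∈ G → f ∉ point e → F ≡ G
  line-unique {e = e} {f} flF flG rF rG eF fF eG fG f∉ = trans (sym (spanned flF rF eF fF)) (spanned flG rG eG fG)
    where
    L = closure M (⁅ e ⁆ ∪ ⁅ f ⁆)
    spanned : ∀ {F} → IsFlat M F → rank M F ≤ 2 → e ∈ F → f ∈ F → L ≡ F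
    spanned fl r e∈ f∈ = flat-≡ M (closure-flat M _) (closure-least M fl (∪-lub (⁅⁆⊆ e∈) (⁅⁆⊆ f∈)))
      (≤-trans r (2≤rank (⊆closure M (p⊆p∪q ⁅ f ⁆ (x∈⁅x⁆ e))) (⊆closure M (q⊆p∪q ⁅ e ⁆ ⁅ f ⁆ (x∈⁅x⁆ f))) f∉))

-- Isomorphisms in rank two

module _ {n : ℕ} (M N : Matroid n) (lM : Loopless M) (lN : Loopless N) where

  private
    module M = Points M lM
    module N = Points N lN

  -- The empty case is treated apart because the comparisons of ranks below start from an element of
  -- the preimage.
  rank-⊥-preimage : ∀ {g : Fin n → Fin n} → (∀ z → ∃ λ x → g x ≡ z) → ∀ Y → ¬ (∃ λ x → x ∈ preimage g Y) →
                    rank N Y ≡ rank M (preimage g Y)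
  rank-⊥-preimage {g} surj Y empty = trans
    (n≤0⇒n≡0 (≤-trans (rank-mono N Y ⊥ Y⊆⊥) (≤-reflexive (rank-⊥ N))))
    (sym (n≤0⇒n≡0 (≤-trans (rank-mono M _ ⊥ (λ x∈ → ⊥-elim (empty (_ , x∈)))) (≤-reflexive (rank-⊥ M)))))
    where
    Y⊆⊥ : Y ⊆ ⊥
    Y⊆⊥ {y} y∈ with surj y
    ... | x , refl = ⊥-elim (empty (x , ∈-preimage⁺ y∈))

  -- In rank at most two, the rank of a set depends only on whether it meets no, one or several
  -- rank-one flats.
  rank-2-isomorphic : rank M ⊤ ≤ 2 → rank N ⊤ ≤ 2 → ∀ (g : Fin n → Fin n) → (∀ {x y} → g x ≡ g y → x ≡ y) →
    (∀ {x y} → M.point x ≡ M.point y → N.point (g x) ≡ N.point (g y)) →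
    (∀ {x y} → N.point (g x) ≡ N.point (g y) → M.point x ≡ M.point y) → Isomorphic M N
  rank-2-isomorphic rM rN g inj to from = injection⇒isomorphic M N g inj rank≡
    where
    surj = injective⇒surjective inj
    rank≡ : ∀ Y → rank N Y ≡ rank M (preimage g Y)
    rank≡ Y with any? (_∈? preimage g Y)
    ... | no empty = rank-⊥-preimage surj Y empty
    ... | yes (x , x∈) with any? (λ y → (y ∈? preimage g Y) ×-dec ¬? (y ∈? M.point x))
    ...   | yes (y , y∈ , y∉) = trans
      (≤-antisym (≤-trans (rank-mono N Y ⊤ (λ _ → ∈⊤)) rN)
                 (N.2≤rank (∈-preimage⁻ x∈) (∈-preimage⁻ y∈) (λ gy∈ → y∉ (subst (y ∈_) (sym (from (N.point-≡ gy∈))) (M.∈-point y)))))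
      (sym (≤-antisym (≤-trans (rank-mono M _ ⊤ (λ _ → ∈⊤)) rM) (M.2≤rank x∈ y∈ y∉)))
    ...   | no all = trans
      (≤-antisym (≤-trans (rank-mono N Y (N.point (g x)) Y⊆) (≤-reflexive (N.rank-point (g x)))) (N.1≤rank (∈-preimage⁻ x∈)))
      (sym (≤-antisym (≤-trans (rank-mono M _ _ X⊆) (≤-reflexive (M.rank-point x))) (M.1≤rank x∈)))
      where
      X⊆ : preimage g Y ⊆ M.point x
      X⊆ {y} y∈ with y ∈? M.point x
      ... | yes p = p
      ... | no ¬p = ⊥-elim (all (y , y∈ , ¬p))
      Y⊆ : Y ⊆ N.point (g x)
      Y⊆ {z} z∈ with surj z
      ... | y , refl = subst (g y ∈_) (sym (to (M.point-≡ (X⊆ (∈-preimage⁺ z∈))))) (N.∈-point (g y))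

-- Sets embedded in the cone

module ConeSets (n m : ℕ) where

  open Cone n m

  base-injective : ∀ {e f} → encode (base e) ≡ encode (base f) → e ≡ f
  base-injective {e} {f} eq with encode-injective {base e} {base f} eq
  ... | refl = refl

  tee-injective : ∀ {e f i j} → encode (tee e i) ≡ encode (tee f j) → e ≡ f × i ≡ j
  tee-injective {e} {f} {i} {j} eq with encode-injective {tee e i} {tee f j} eq
  ... | refl = refl , refl

  base∈embE⁻ : ∀ {S e} → encode (base e) ∈ embE m S → e ∈ S
  base∈embE⁻ {S} {e} p with ∈-embE⁻ {S} p
  ... | f , f∈ , eq with trans (sym (decode-encode (base e))) eq
  ... | refl = f∈

  base∈qSet⁺ : ∀ {S e} → e ∈ S → encode (base e) ∈ qSet m S
  base∈qSet⁺ {e = e} e∈ = ∈-qSet⁺ e∈ (cong supportOf (decode-encode (base e)))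

  base∈qSet⁻ : ∀ {S e} → encode (base e) ∈ qSet m S → e ∈ S
  base∈qSet⁻ {S} {e} p with ∈-qSet⁻ {S} p
  ... | inj₂ (f , f∈ , eq) with trans (sym (cong supportOf (decode-encode (base e)))) eq
  ... | refl = f∈

  tip∉embE : ∀ {S} → zero ∉ embE m S
  tip∉embE {S} p with ∈-embE⁻ {S} p
  ... | _ , _ , ()

  embE⊆ : ∀ {S X} → (∀ {e} → e ∈ S → encode (base e) ∈ X) → embE m S ⊆ X
  embE⊆ {S} {X} f {x} x∈ with ∈-embE⁻ {S} x∈
  ... | e , e∈ , dx = subst (_∈ X) (sym (decode⁻ {x} dx)) (f e∈)

  qSet-mono : ∀ {S T} → S ⊆ T → qSet m S ⊆ qSet m T
  qSet-mono {S} {T} f {x} x∈ with ∈-qSet⁻ {S} x∈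
  ... | inj₁ refl          = tip∈qSet
  ... | inj₂ (e , e∈ , sx) = ∈-qSet⁺ (f e∈) sx

  qSet-⊆⁻ : ∀ {S T} → qSet m S ⊆ qSet m T → S ⊆ T
  qSet-⊆⁻ f = base∈qSet⁻ ∘ f ∘ base∈qSet⁺

  embE⊆qSet : ∀ {S T} → S ⊆ T → embE m S ⊆ qSet m T
  embE⊆qSet f = embE⊆ (base∈qSet⁺ ∘ f)

  embE⊆qSet⁻ : ∀ {S T} → embE m S ⊆ qSet m T → S ⊆ T
  embE⊆qSet⁻ f = base∈qSet⁻ ∘ f ∘ ∈-embE⁺

  ∈-qSet-full : ∀ {S} → (∀ e → e ∈ S) → ∀ x → x ∈ qSet m S
  ∈-qSet-full {S} full x with supportOf (decode m x) in sx
  ... | just e  = ∈-qSet⁺ (full e) sx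
  ... | nothing = subst (_∈ qSet m S) (sym (supportOf-nothing {x} sx)) tip∈qSet

  -- Intersection with E, which recovers `S` both from `embE m S` and from `qSet m S`.
  trace : Subset (suc (n + n * m)) → Subset n
  trace = preimage (encode ∘ base)

  trace-embE : ∀ S → trace (embE m S) ≡ S
  trace-embE S = ⊆-antisym (base∈embE⁻ ∘ ∈-preimage⁻ {g = encode ∘ base}) (∈-preimage⁺ {g = encode ∘ base} ∘ ∈-embE⁺)

  trace-qSet : ∀ S → trace (qSet m S) ≡ S
  trace-qSet S = ⊆-antisym (base∈qSet⁻ ∘ ∈-preimage⁻ {g = encode ∘ base}) (∈-preimage⁺ {g = encode ∘ base} ∘ base∈qSet⁺)

  ∣embE∣ : ∀ S → ∣ embE m S ∣ ≡ ∣ S ∣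
  ∣embE∣ S = trans (∣∣≡length {xs = map (encode ∘ base) (elements S)}
      (Uniq.map⁺ base-injective (elements-unique S)) from to)
    (trans (length-map (encode ∘ base) (elements S)) (length-elements S))
    where
    from : ∀ {x} → x ∈ₗ map (encode ∘ base) (elements S) → x ∈ embE m S
    from x∈ with ∈-map⁻ (encode ∘ base) x∈
    ... | e , e∈ , refl = ∈-embE⁺ (∈-elements⁻ e∈)
    to : ∀ {x} → x ∈ embE m S → x ∈ₗ map (encode ∘ base) (elements S)
    to {x} x∈ with ∈-embE⁻ {S} x∈
    ... | e , e∈ , dx = subst (_∈ₗ _) (sym (decode⁻ {x} dx)) (∈-map⁺ (encode ∘ base) (∈-elements⁺ e∈))

  ∣qSet∣ : ∀ S → ∣ qSet m S ∣ ≡ suc (∣ S ∣ + ∣ S ∣ * m)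
  ∣qSet∣ S = trans (∣∣≡length {xs = zero ∷ Bs ++ Ts} unique from to) (cong suc (begin
      length (Bs ++ Ts)          ≡⟨ length-++ Bs ⟩
      length Bs + length Ts      ≡⟨ cong₂ _+_ (length-map (encode ∘ base) els) (length-product els (allFin m)) ⟩
      length els + length els * length (allFin m) ≡⟨ cong₂ (λ a b → a + a * b) (length-elements S) (length-tabulate {n = m} id) ⟩
      ∣ S ∣ + ∣ S ∣ * m          ∎))
    where
    open ≡-Reasoning
    els = elements S
    Bs = map (encode ∘ base) els
    Ts = cartesianProductWith (λ e j → encode (tee e j)) els (allFin m)
    length-product : ∀ {A B C : Set} {f : A → B → C} xs ys →
      length (cartesianProductWith f xs ys) ≡ length xs * length ys
    length-product [] ys = refl
    length-product {f = f} (x ∷ xs) ys = trans (length-++ (map (f x) ys))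
      (cong₂ _+_ (length-map (f x) ys) (length-product xs ys))
    Bs⁻ : ∀ {x} → x ∈ₗ Bs → ∃ λ e → e ∈ S × x ≡ encode (base e)
    Bs⁻ x∈ with ∈-map⁻ (encode ∘ base) x∈
    ... | e , e∈ , eq = e , ∈-elements⁻ e∈ , eq
    Ts⁻ : ∀ {x} → x ∈ₗ Ts → ∃ λ e → ∃ λ j → e ∈ S × x ≡ encode (tee e j)
    Ts⁻ x∈ with ∈-cartesianProductWith⁻ (λ e j → encode (tee e j)) els (allFin m) x∈
    ... | e , j , e∈ , _ , eq = e , j , ∈-elements⁻ e∈ , eq
    disjoint : ∀ {x} → ¬ (x ∈ₗ Bs × x ∈ₗ Ts)
    disjoint (b , t) with Bs⁻ b | Ts⁻ t
    ... | e , _ , eq | f , j , _ , eq′ with encode-injective {base e} {tee f j} (trans (sym eq) eq′)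
    ... | ()
    zero∉ : ∀ {x} → x ∈ₗ Bs ++ Ts → zero ≢ x
    zero∉ x∈ z≡x with ∈-++⁻ Bs x∈
    ... | inj₁ b with Bs⁻ b
    ...   | e , _ , eq with trans z≡x eq
    ...     | ()
    zero∉ x∈ z≡x | inj₂ t with Ts⁻ t
    ...   | e , j , _ , eq with trans z≡x eq
    ...     | ()
    unique : Unique (zero ∷ Bs ++ Ts)
    unique = All.tabulate zero∉ ∷ Uniq.++⁺ (Uniq.map⁺ base-injective (elements-unique S))
      (Uniq.cartesianProductWith⁺ _ tee-injective (elements-unique S) (Uniq.allFin⁺ m)) disjoint
    from : ∀ {x} → x ∈ₗ zero ∷ Bs ++ Ts → x ∈ qSet m S
    from (here refl) = tip∈qSet
    from (there x∈) with ∈-++⁻ Bs x∈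
    ... | inj₁ b with Bs⁻ b
    ...   | e , e∈ , refl = base∈qSet⁺ e∈
    from (there x∈) | inj₂ t with Ts⁻ t
    ...   | e , j , e∈ , refl = ∈-qSet⁺ e∈ (cong supportOf (decode-encode (tee e j)))
    to : ∀ {x} → x ∈ qSet m S → x ∈ₗ zero ∷ Bs ++ Ts
    to {x} x∈ with ∈-qSet⁻ {S} x∈
    ... | inj₁ refl = here refl
    ... | inj₂ (e , e∈ , sx) = there (go (decode m x) refl)
      where
      go : ∀ κ → decode m x ≡ κ → x ∈ₗ Bs ++ Ts
      go tip dx with trans (sym sx) (cong supportOf dx)
      ... | ()
      go (base f) dx with trans (sym sx) (cong supportOf dx)
      ... | refl = ∈-++⁺ˡ (subst (_∈ₗ Bs) (sym (decode⁻ {x} dx)) (∈-map⁺ (encode ∘ base) (∈-elements⁺ e∈)))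
      go (tee f j) dx with trans (sym sx) (cong supportOf dx)
      ... | refl = ∈-++⁺ʳ Bs (subst (_∈ₗ Ts) (sym (decode⁻ {x} dx))
                     (∈-cartesianProductWith⁺ (λ e j → encode (tee e j)) (∈-elements⁺ e∈) (∈-allFin j)))

  ∣qSet∣-injective : ∀ {S T} → ∣ qSet m S ∣ ≡ ∣ qSet m T ∣ → ∣ S ∣ ≡ ∣ T ∣
  ∣qSet∣-injective {S} {T} eq = *-cancelʳ-≡ _ _ (suc m)
    (suc-injective (trans (cong suc (*-suc ∣ S ∣ m)) (trans (sym (∣qSet∣ S)) (trans eq (trans (∣qSet∣ T) (cong suc (sym (*-suc ∣ T ∣ m))))))))

-- Correspondences between lattices of cyclic flats

-- A symmetric form of `SameConfig` with an explicit inverse, so that arguments can be run in both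
-- directions through `flip`.
record Correspondence {k k′ : ℕ} (Q : Matroid k) (Q′ : Matroid k′) : Set where
  field
    φ      : Subset k → Subset k′
    ψ      : Subset k′ → Subset k
    φ-cf   : ∀ {X} → IsCyclicFlat Q X → IsCyclicFlat Q′ (φ X)
    ψ-cf   : ∀ {Y} → IsCyclicFlat Q′ Y → IsCyclicFlat Q (ψ Y)
    ψφ     : ∀ {X} → IsCyclicFlat Q X → ψ (φ X) ≡ X
    φψ     : ∀ {Y} → IsCyclicFlat Q′ Y → φ (ψ Y) ≡ Y
    φ-mono : ∀ {X X′} → IsCyclicFlat Q X → IsCyclicFlat Q X′ → X ⊆ X′ → φ X ⊆ φ X′
    ψ-mono : ∀ {Y Y′} → IsCyclicFlat Q′ Y → IsCyclicFlat Q′ Y′ → Y ⊆ Y′ → ψ Y ⊆ ψ Y′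
    φ-size : ∀ {X} → IsCyclicFlat Q X → ∣ φ X ∣ ≡ ∣ X ∣
    φ-rank : ∀ {X} → IsCyclicFlat Q X → rank Q′ (φ X) ≡ rank Q X
    ψ-size : ∀ {Y} → IsCyclicFlat Q′ Y → ∣ ψ Y ∣ ≡ ∣ Y ∣
    ψ-rank : ∀ {Y} → IsCyclicFlat Q′ Y → rank Q (ψ Y) ≡ rank Q′ Y

flip : ∀ {k k′} {Q : Matroid k} {Q′ : Matroid k′} → Correspondence Q Q′ → Correspondence Q′ Q
flip C = record
  { φ = ψ ; ψ = φ ; φ-cf = ψ-cf ; ψ-cf = φ-cf ; ψφ = φψ ; φψ = ψφ ; φ-mono = ψ-mono ; ψ-mono = φ-mono
  ; φ-size = ψ-size ; φ-rank = ψ-rank ; ψ-size = φ-size ; ψ-rank = φ-rank }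
  where open Correspondence C

correspondence : ∀ {k k′} {Q : Matroid k} {Q′ : Matroid k′} → SameConfig Q Q′ → Correspondence Q Q′
correspondence {k} {k′} {Q} {Q′} (φ , cf , surj , order , size , rk) = record
  { φ = φ ; ψ = ψ ; φ-cf = cf _ ; ψ-cf = ψ-cf ; φψ = φψ
  ; ψφ = λ cX → ⊆-antisym (reflect (ψ-cf (cf _ cX)) cX (λ p → subst (_ ∈_) (φψ (cf _ cX)) p))
                          (reflect cX (ψ-cf (cf _ cX)) (λ p → subst (_ ∈_) (sym (φψ (cf _ cX))) p))
  ; φ-mono = λ cX cX′ → proj₁ (order _ _ cX cX′)
  ; ψ-mono = λ cY cY′ Y⊆Y′ → reflect (ψ-cf cY) (ψ-cf cY′)
      (λ p → subst (_ ∈_) (sym (φψ cY′)) (Y⊆Y′ (subst (_ ∈_) (φψ cY) p)))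
  ; φ-size = size _ ; φ-rank = rk _
  ; ψ-size = λ cY → trans (sym (size _ (ψ-cf cY))) (cong ∣_∣ (φψ cY))
  ; ψ-rank = λ cY → trans (sym (rk _ (ψ-cf cY))) (cong (rank Q′) (φψ cY)) }
  where
  ψ : Subset k′ → Subset k
  ψ Y with cyclicFlat? Q′ Y
  ... | yes cY = proj₁ (surj Y cY)
  -- A default value; every law of `Correspondence` speaks of cyclic flats only.
  ... | no  _  = ⊥
  ψ-cf : ∀ {Y} → IsCyclicFlat Q′ Y → IsCyclicFlat Q (ψ Y)
  ψ-cf {Y} cY with cyclicFlat? Q′ Y
  ... | yes cY′ = proj₁ (proj₂ (surj Y cY′))
  ... | no ¬cY  = ⊥-elim (¬cY cY)
  φψ : ∀ {Y} → IsCyclicFlat Q′ Y → φ (ψ Y) ≡ Y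
  φψ {Y} cY with cyclicFlat? Q′ Y
  ... | yes cY′ = proj₂ (proj₂ (surj Y cY′))
  ... | no ¬cY  = ⊥-elim (¬cY cY)
  reflect : ∀ {X X′} → IsCyclicFlat Q X → IsCyclicFlat Q X′ → φ X ⊆ φ X′ → X ⊆ X′
  reflect cX cX′ = proj₂ (order _ _ cX cX′)

-- Cyclic flats of the cone with and without the tip

module ConeFlats {n m : ℕ} (M : Matroid n) (loopless : Loopless M)
  (Q : Matroid (suc (n + n * m))) (cone : IsFreeCone M m Q) where

  open Cone n m
  open ConeSets n m
  open Points M loopless

  embE-cf : ∀ {Z} → IsCyclicFlat M Z → IsCyclicFlat Q (embE m Z)
  embE-cf cZ = proj₂ (proj₁ cone _) (inj₁ (_ , cZ , refl))

  qSet-cf : ∀ {F e} → IsFlat M F → e ∈ F → IsCyclicFlat Q (qSet m F)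
  qSet-cf fl e∈ = proj₂ (proj₁ cone _) (inj₂ (_ , fl , (_ , e∈) , refl))

  cf-without-tip : ∀ {X} → IsCyclicFlat Q X → zero ∉ X →
    ∃ λ Z → IsCyclicFlat M Z × X ≡ embE m Z × rank Q X ≡ rank M Z
  cf-without-tip cX tip∉ with proj₁ (proj₁ cone _) cX
  ... | inj₁ (Z , cZ , refl) = Z , cZ , refl , proj₁ (proj₂ cone) Z cZ
  ... | inj₂ (F , _ , _ , refl) = ⊥-elim (tip∉ tip∈qSet)

  cf-with-tip : ∀ {X} → IsCyclicFlat Q X → zero ∈ X →
    ∃ λ F → IsFlat M F × (∃ λ e → e ∈ F) × X ≡ qSet m F × rank Q X ≡ suc (rank M F)
  cf-with-tip cX tip∈ with proj₁ (proj₁ cone _) cX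
  ... | inj₁ (Z , _ , refl) = ⊥-elim (tip∉embE {Z} tip∈)
  ... | inj₂ (F , fl , ne , refl) = F , fl , ne , refl , proj₂ (proj₂ cone) F fl ne

  rank-qSet : ∀ {F e} → IsFlat M F → e ∈ F → rank Q (qSet m F) ≡ suc (rank M F)
  rank-qSet fl e∈ = proj₂ (proj₂ cone) _ fl (_ , e∈)

  cone-point : Fin n → Subset (suc (n + n * m))
  cone-point e = qSet m (point e)

  cone-point-cf : ∀ e → IsCyclicFlat Q (cone-point e)
  cone-point-cf e = qSet-cf (point-flat e) (∈-point e)

  rank-cone-point : ∀ e → rank Q (cone-point e) ≡ 2
  rank-cone-point e = trans (rank-qSet (point-flat e) (∈-point e)) (cong suc (rank-point e))

  cone-point-injective : ∀ e f → cone-point e ≡ cone-point f → point e ≡ point f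
  cone-point-injective e f eq = trans (sym (trace-qSet (point e))) (trans (cong trace eq) (trace-qSet (point f)))

-- Blue and red points

module _ {n m : ℕ} (1≤m : 1 ≤ m) where

  open Cone n m
  open ConeSets n m

  module Compare (M N : Matroid n) (lM : Loopless M) (lN : Loopless N)
    (Q Q′ : Matroid (suc (n + n * m))) (cM : IsFreeCone M m Q) (cN : IsFreeCone N m Q′)
    (C : Correspondence Q Q′) where

    open Correspondence C
    private
      module M where
        open Points M lM public
        open ConeFlats M lM Q cM public
      module N where
        open Points N lN public
        open ConeFlats N lN Q′ cN public

    image : Fin n → Subset (suc (n + n * m))
    image e = φ (M.cone-point e)

    -- This is the flat G if `e` is blue and the flat Z if `e` is red.
    shadow : Fin n → Subset n
    shadow e = trace (image e)

    -- Colours are given to elements; by `image-cong` they depend only on the rank-one flat through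
    -- the element.
    Blue Red : Fin n → Set
    Blue e = zero ∈ image e
    Red  e = zero ∉ image e

    image-cf : ∀ e → IsCyclicFlat Q′ (image e)
    image-cf e = φ-cf (M.cone-point-cf e)

    ψ-image : ∀ e → ψ (image e) ≡ M.cone-point e
    ψ-image e = ψφ (M.cone-point-cf e)

    image-injective : ∀ e f → image e ≡ image f → M.point e ≡ M.point f
    image-injective e f eq = M.cone-point-injective e f (trans (sym (ψ-image e)) (trans (cong ψ eq) (ψ-image f)))

    image-cong : ∀ e f → M.point e ≡ M.point f → image e ≡ image f
    image-cong e f eq = cong (φ ∘ qSet m) eq

    rank-image : ∀ e → rank Q′ (image e) ≡ 2
    rank-image e = trans (φ-rank (M.cone-point-cf e)) (M.rank-cone-point e)

    record BlueShadow (e : Fin n) : Set where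
      field
        flat    : IsFlat N (shadow e)
        rank≡1  : rank N (shadow e) ≡ 1
        image≡  : image e ≡ qSet m (shadow e)
        size    : ∣ shadow e ∣ ≡ ∣ M.point e ∣

    record RedShadow (e : Fin n) : Set where
      field
        cf      : IsCyclicFlat N (shadow e)
        rank≡2  : rank N (shadow e) ≡ 2
        image≡  : image e ≡ embE m (shadow e)
        size    : ∣ shadow e ∣ ≡ ∣ M.cone-point e ∣

    blue : ∀ e → Blue e → BlueShadow e
    blue e b = go (N.cf-with-tip (image-cf e) b)
      where
      go : (∃ λ G → IsFlat N G × (∃ λ y → y ∈ G) × image e ≡ qSet m G × rank Q′ (image e) ≡ suc (rank N G)) → BlueShadow e
      go (G , fl , _ , eq , r) = record
        { flat   = subst (IsFlat N) G≡ fl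
        ; rank≡1 = trans (cong (rank N) (sym G≡)) (suc-injective (trans (sym r) (rank-image e)))
        ; image≡ = trans eq (cong (qSet m) G≡)
        ; size   = trans (cong ∣_∣ (sym G≡)) (∣qSet∣-injective {G} {M.point e} (trans (cong ∣_∣ (sym eq)) (φ-size (M.cone-point-cf e)))) }
        where
        G≡ : G ≡ shadow e
        G≡ = sym (trans (cong trace eq) (trace-qSet G))

    red : ∀ e → Red e → RedShadow e
    red e r = go (N.cf-without-tip (image-cf e) r)
      where
      go : (∃ λ Z → IsCyclicFlat N Z × image e ≡ embE m Z × rank Q′ (image e) ≡ rank N Z) → RedShadow e
      go (Z , cZ , eq , rk) = record
        { cf     = subst (IsCyclicFlat N) Z≡ cZ
        ; rank≡2 = trans (cong (rank N) (sym Z≡)) (trans (sym rk) (rank-image e))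
        ; image≡ = trans eq (cong (embE m) Z≡)
        ; size   = trans (cong ∣_∣ (sym Z≡)) (trans (sym (∣embE∣ Z)) (trans (cong ∣_∣ (sym eq)) (φ-size (M.cone-point-cf e)))) }
        where
        Z≡ : Z ≡ shadow e
        Z≡ = sym (trans (cong trace eq) (trace-embE Z))

    blue-image : ∀ e → Blue e → image e ≡ qSet m (shadow e)
    blue-image e isE = BlueShadow.image≡ (blue e isE)

    red-image : ∀ e → Red e → image e ≡ embE m (shadow e)
    red-image e isE = RedShadow.image≡ (red e isE)

    shadow-blue-injective : ∀ x y → Blue x → Blue y → shadow x ≡ shadow y → M.point x ≡ M.point y
    shadow-blue-injective x y bx by eq = image-injective x y
      (trans (blue-image x bx) (trans (cong (qSet m) eq) (sym (blue-image y by))))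

    shadow-red-injective : ∀ x y → Red x → Red y → shadow x ≡ shadow y → M.point x ≡ M.point y
    shadow-red-injective x y rx ry eq = image-injective x y
      (trans (red-image x rx) (trans (cong (embE m) eq) (sym (red-image y ry))))

    shadow-blue : ∀ x {z} → Blue x → z ∈ shadow x → shadow x ≡ N.point z
    shadow-blue x bx z∈ = N.point-unique (BlueShadow.flat (blue x bx)) (BlueShadow.rank≡1 (blue x bx)) z∈

    red-line-unique : ∀ x y → Red x → Red y → ∀ {e f} → e ∈ shadow x → f ∈ shadow x → e ∈ shadow y → f ∈ shadow y →
                      f ∉ N.point e → shadow x ≡ shadow y
    red-line-unique x y rx ry = N.line-unique (proj₂ (cf (red x rx))) (proj₂ (cf (red y ry)))
      (≤-reflexive (rank≡2 (red x rx))) (≤-reflexive (rank≡2 (red y ry)))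
      where open RedShadow

    -- Without red points, φ restricts to an isomorphism of the lattices of flats.
    module AllBlue (allBlue : ∀ e → Blue e) where

      open Glue M.point shadow M.∈-point
        (λ x y z∈x z∈y → shadow-blue-injective x y (allBlue x) (allBlue y)
          (trans (shadow-blue x (allBlue x) z∈x) (sym (shadow-blue y (allBlue y) z∈y))))
        (λ x y eq → cong trace (image-cong x y eq))
        (λ x → ≤-reflexive (sym (BlueShadow.size (blue x (allBlue x)))))

      image-glue : ∀ x → image x ≡ N.cone-point (glue x)
      image-glue x = trans (blue-image x (allBlue x))
                           (cong (qSet m) (shadow-blue x (allBlue x) (glue-∈ x)))

      ψ-cone-point : ∀ x → ψ (N.cone-point (glue x)) ≡ M.cone-point x
      ψ-cone-point x = trans (cong ψ (sym (image-glue x))) (ψ-image x)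

      module _ (Y : Subset n) {x₀ : Fin n} (x₀∈ : x₀ ∈ preimage glue Y) where

        X = preimage glue Y

        -- With `K` the closure of `X`, the cyclic flat φ(q(K)) contains a blue image, hence the
        -- tip, and so is some q(F). As it contains the images of all elements of `X`, `F` contains
        -- `Y`, and r(F) = r(K).
        rank-≤ˡ : rank N Y ≤ rank M X
        rank-≤ˡ = go (N.cf-with-tip (φ-cf K-cf) (image⊆ x₀ x₀∈ (allBlue x₀)))
          where
          K = closure M X
          K-cf : IsCyclicFlat Q (qSet m K)
          K-cf = M.qSet-cf (closure-flat M X) (⊆closure M x₀∈)
          image⊆ : ∀ x → x ∈ X → image x ⊆ φ (qSet m K)
          image⊆ x x∈ = φ-mono (M.cone-point-cf x) K-cf (qSet-mono (M.point⊆ (closure-flat M X) (⊆closure M x∈)))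
          go : (∃ λ F → IsFlat N F × (∃ λ e → e ∈ F) × φ (qSet m K) ≡ qSet m F × rank Q′ (φ (qSet m K)) ≡ suc (rank N F)) →
               rank N Y ≤ rank M X
          go (F , _ , _ , eq , r) = begin
            rank N Y ≤⟨ rank-mono N Y F Y⊆F ⟩
            rank N F ≡⟨ suc-injective (trans (sym r) (trans (φ-rank K-cf) (M.rank-qSet (closure-flat M X) (⊆closure M x₀∈)))) ⟩
            rank M K ≡⟨ rank-closure M X ⟩
            rank M X ∎
            where
            open ≤-Reasoning
            Y⊆F : Y ⊆ F
            Y⊆F {y} y∈ = onto (injective⇒surjective glue-injective y)
              where
              onto : (∃ λ x → glue x ≡ y) → y ∈ F
              onto (x , eq′) = qSet-⊆⁻ {N.point (glue x)} {F}
                (λ {z} p → subst (z ∈_) eq (image⊆ x (∈-preimage⁺ (subst (_∈ Y) (sym eq′) y∈)) (subst (z ∈_) (sym (image-glue x)) p)))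
                (subst (_∈ N.point (glue x)) eq′ (N.∈-point (glue x)))

        -- The mirror argument, with ψ and the closure of `Y`.
        rank-≥ˡ : rank M X ≤ rank N Y
        rank-≥ˡ = go (M.cf-with-tip (ψ-cf K-cf) (cone-point⊆ x₀ x₀∈ (tip∈qSet {M.point x₀})))
          where
          K = closure N Y
          K-cf : IsCyclicFlat Q′ (qSet m K)
          K-cf = N.qSet-cf (closure-flat N Y) (⊆closure N (∈-preimage⁻ x₀∈))
          cone-point⊆ : ∀ x → x ∈ X → M.cone-point x ⊆ ψ (qSet m K)
          cone-point⊆ x x∈ {z} p = ψ-mono (N.cone-point-cf (glue x)) K-cf
            (qSet-mono (N.point⊆ (closure-flat N Y) (⊆closure N (∈-preimage⁻ x∈))))
            (subst (z ∈_) (sym (ψ-cone-point x)) p)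
          go : (∃ λ F → IsFlat M F × (∃ λ e → e ∈ F) × ψ (qSet m K) ≡ qSet m F × rank Q (ψ (qSet m K)) ≡ suc (rank M F)) →
               rank M X ≤ rank N Y
          go (F , _ , _ , eq , r) = begin
            rank M X ≤⟨ rank-mono M X F (λ {x} x∈ → qSet-⊆⁻ {M.point x} {F} (λ {z} p → subst (z ∈_) eq (cone-point⊆ x x∈ p)) (M.∈-point x)) ⟩
            rank M F ≡⟨ suc-injective (trans (sym r) (trans (ψ-rank K-cf) (N.rank-qSet (closure-flat N Y) (⊆closure N (∈-preimage⁻ x₀∈))))) ⟩
            rank N K ≡⟨ rank-closure N Y ⟩
            rank N Y ∎
            where open ≤-Reasoning

      isomorphic : Isomorphic M N
      isomorphic = injection⇒isomorphic M N glue glue-injective rank≡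
        where
        rank≡ : ∀ Y → rank N Y ≡ rank M (preimage glue Y)
        rank≡ Y = go (any? (_∈? preimage glue Y))
          where
          go : Dec (∃ λ x → x ∈ preimage glue Y) → rank N Y ≡ rank M (preimage glue Y)
          go (no empty)     = rank-⊥-preimage M N lM lN (injective⇒surjective glue-injective) Y empty
          go (yes (x , x∈)) = ≤-antisym (rank-≤ˡ Y x∈) (rank-≥ˡ Y x∈)

    -- ψ(Y) contains the cone over every point, so it is the cone over all of E, the greatest cyclic
    -- flat. Hence `Y` is the greatest one in `Q′`. The element `e₀` ensures that the tip is in
    -- ψ(Y).
    image-cover : ∀ {Y} → Fin n → IsCyclicFlat Q′ Y → (∀ e → image e ⊆ Y) → qSet {n} m ⊤ ⊆ Y
    image-cover {Y} e₀ cY cover = go (M.cf-with-tip (ψ-cf cY) (below e₀ (tip∈qSet {M.point e₀})))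
      where
      below : ∀ e → M.cone-point e ⊆ ψ Y
      below e {z} p = ψ-mono (image-cf e) cY (cover e) (subst (z ∈_) (sym (ψ-image e)) p)
      ⊤-cf : IsCyclicFlat Q′ (qSet {n} m ⊤)
      ⊤-cf = N.qSet-cf (⊤-flat N) (∈⊤ {x = e₀})
      go : (∃ λ F → IsFlat M F × (∃ λ e → e ∈ F) × ψ Y ≡ qSet m F × rank Q (ψ Y) ≡ suc (rank M F)) → qSet {n} m ⊤ ⊆ Y
      go (F , fl , _ , eq , r) {z} p = subst (z ∈_) (φψ cY) (φ-mono (ψ-cf ⊤-cf) (ψ-cf cY)
        (λ {x} _ → subst (x ∈_) (sym eq) (∈-qSet-full full x)) (subst (z ∈_) (sym (φψ ⊤-cf)) p))
        where
        full : ∀ e → e ∈ F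
        full e = qSet-⊆⁻ {M.point e} {F} (λ {z} p → subst (z ∈_) eq (below e p)) (M.∈-point e)

    -- The join of cyclic flats of N is again a cyclic flat of N, so cannot be the whole cone.
    allRed-absurd : (∀ e → Red e) → ¬ Fin n
    allRed-absurd allRed e₀ = go (cover (allFin n))
      where
      Cover : List (Fin n) → Set
      Cover es = ∃ λ K → IsCyclicFlat N K × (∀ {e} → e ∈ₗ es → image e ⊆ embE m K)
      add : ∀ e es → Cover es → Cover (e ∷ es)
      add e es (K , cK , below) = K′ , closure-cyclicFlat N (cyclic-∪ N (proj₁ cK) (proj₁ (RedShadow.cf (red e (allRed e))))) , below′
        where
        K′ = closure N (K ∪ shadow e)
        below′ : ∀ {f} → f ∈ₗ e ∷ es → image f ⊆ embE m K′
        below′ (here refl) {z} p = embE⊆ {shadow e} (λ q → ∈-embE⁺ (⊆closure N (q⊆p∪q K (shadow e) q)))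
          (subst (z ∈_) (red-image e (allRed e)) p)
        below′ (there f∈) p = embE⊆ {K} (λ q → ∈-embE⁺ (⊆closure N (p⊆p∪q (shadow e) q))) (below f∈ p)
      cover : ∀ es → Cover es
      cover []       = closure N ⊥ , closure-cyclicFlat N (λ e e∈ → ⊥-elim (∉⊥ e∈)) , λ ()
      cover (e ∷ es) = add e es (cover es)
      go : Cover (allFin n) → Absurd
      -- The join is still embedded from E, while `image-cover` would put the tip into it.
      go (K , cK , below) = tip∉embE {K} (image-cover e₀ (N.embE-cf cK) (λ e → below (∈-allFin e)) (tip∈qSet {⊤}))

    -- Let `K` be the join of the two points. Its image contains the blue image, so it is q(H) with
    -- r(H) at most two. The red shadow is a flat of rank two inside `H` and thus equals `H`, which
    -- also contains the blue shadow.
    blue⊆red : ∀ b r → Blue b → Red r → shadow b ⊆ shadow r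
    blue⊆red b r isB isR = go (N.cf-with-tip (φ-cf K-cf) (image⊆ b b∈K isB))
      where
      K = closure M (⁅ r ⁆ ∪ ⁅ b ⁆)
      K-flat : IsFlat M K
      K-flat = closure-flat M _
      r∈K : r ∈ K
      r∈K = ⊆closure M (p⊆p∪q ⁅ b ⁆ (x∈⁅x⁆ r))
      b∈K : b ∈ K
      b∈K = ⊆closure M (q⊆p∪q ⁅ r ⁆ ⁅ b ⁆ (x∈⁅x⁆ b))
      K-cf : IsCyclicFlat Q (qSet m K)
      K-cf = M.qSet-cf K-flat r∈K
      rank-K : rank M K ≤ 2
      rank-K = ≤-trans (≤-reflexive (rank-closure M _))
        (≤-trans (rank-∪⁅⁆≤ M ⁅ r ⁆ b) (s≤s (≤-reflexive (lM r))))
      image⊆ : ∀ x → x ∈ K → image x ⊆ φ (qSet m K)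
      image⊆ x x∈ = φ-mono (M.cone-point-cf x) K-cf (qSet-mono (M.point⊆ K-flat x∈))
      go : (∃ λ H → IsFlat N H × (∃ λ e → e ∈ H) × φ (qSet m K) ≡ qSet m H × rank Q′ (φ (qSet m K)) ≡ suc (rank N H)) →
           shadow b ⊆ shadow r
      go (H , _ , _ , eq , rH) {z} z∈ = subst (z ∈_) (sym Z≡H) (b⊆H z∈)
        where
        open RedShadow (red r isR)
        rank-H : rank N H ≤ 2
        rank-H = ≤-trans (≤-reflexive (suc-injective (trans (sym rH) (trans (φ-rank K-cf) (M.rank-qSet K-flat r∈K))))) rank-K
        Z⊆H : shadow r ⊆ H
        Z⊆H = embE⊆qSet⁻ {shadow r} {H} (λ {z} p → subst (z ∈_) eq (image⊆ r r∈K (subst (z ∈_) (sym image≡) p)))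
        Z≡H : shadow r ≡ H
        Z≡H = flat-≡ N (proj₂ cf) Z⊆H (≤-trans rank-H (≤-reflexive (sym rank≡2)))
        b⊆H : shadow b ⊆ H
        b⊆H = qSet-⊆⁻ {shadow b} {H} (λ {z} p → subst (z ∈_) eq (image⊆ b b∈K (subst (z ∈_) (sym (blue-image b isB)) p)))

    shadow-blue-nonempty : ∀ b → Blue b → ∃ λ y → y ∈ shadow b
    shadow-blue-nonempty b isB = N.nonempty-of-rank (≤-reflexive (sym (BlueShadow.rank≡1 (blue b isB))))

    -- All red shadows contain two distinct blue points and hence are the same line. Its cone
    -- contains every image, so by `image-cover` the line is the whole ground set of `N`.
    module TwoBlue (r b b′ : Fin n) (isR : Red r) (isB : Blue b) (isB′ : Blue b′) (b≢b′ : M.point b ≢ M.point b′) where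

      private
        y = proj₁ (shadow-blue-nonempty b isB)
        y∈ = proj₂ (shadow-blue-nonempty b isB)
        y′ = proj₁ (shadow-blue-nonempty b′ isB′)
        y′∈ = proj₂ (shadow-blue-nonempty b′ isB′)

        y′∉ : y′ ∉ N.point y
        y′∉ p = b≢b′ (shadow-blue-injective b b′ isB isB′
          (trans (shadow-blue b isB y∈) (trans (N.point-≡ p) (sym (shadow-blue b′ isB′ y′∈)))))

        red-shadow : ∀ e → Red e → shadow e ≡ shadow r
        red-shadow e isE = red-line-unique e r isE isR
          (blue⊆red b e isB isE y∈) (blue⊆red b′ e isB′ isE y′∈) (blue⊆red b r isB isR y∈) (blue⊆red b′ r isB′ isR y′∈) y′∉

        cover : ∀ e → image e ⊆ qSet m (shadow r)
        cover e {z} p = go (zero ∈? image e)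
          where
          go : Dec (Blue e) → z ∈ qSet m (shadow r)
          go (yes isE) = qSet-mono {shadow e} (blue⊆red e r isE isR) (subst (z ∈_) (blue-image e isE) p)
          go (no isE)  = embE⊆qSet {shadow e} (λ {x} q → subst (x ∈_) (red-shadow e isE) q) (subst (z ∈_) (red-image e isE) p)

        shadow-flat : IsFlat N (shadow r)
        shadow-flat = proj₂ (RedShadow.cf (red r isR))

        covered = image-cover r (N.qSet-cf shadow-flat (blue⊆red b r isB isR y∈)) cover

      red-unique : ∀ e → Red e → M.point e ≡ M.point r
      red-unique e isE = shadow-red-injective e r isE isR (red-shadow e isE)

      shadow-⊤ : shadow r ≡ ⊤
      shadow-⊤ = ⊆-antisym (λ _ → ∈⊤) (qSet-⊆⁻ {⊤} {shadow r} covered)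

      image-⊤ : image r ≡ embE {n} m ⊤
      image-⊤ = trans (red-image r isR) (cong (embE m) shadow-⊤)

      rank-N-⊤ : rank N ⊤ ≡ 2
      rank-N-⊤ = trans (cong (rank N) (sym shadow-⊤)) (RedShadow.rank≡2 (red r isR))

    -- With a single blue class G, the red shadows are lines through G that meet only in G; they are
    -- too large to fit into the ground set of N.
    oneBlue-absurd : ∀ r b → Red r → Blue b → (∀ e → Blue e → M.point e ≡ M.point b) → Absurd
    -- An injective self-map of the finite set E would miss an element.
    oneBlue-absurd r b isR isB only = proj₂ missed _ (proj₂ (injective⇒surjective glue-injective (proj₁ missed)))
      where
      y = proj₁ (shadow-blue-nonempty b isB)
      y∈ = proj₂ (shadow-blue-nonempty b isB)

      G≡ : shadow b ≡ N.point y
      G≡ = shadow-blue b isB y∈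

      -- With a second element, G would be a cyclic flat of rank one. Its preimage under φ has rank
      -- one too, so it is embedded from some nonempty P, and it lies below the cones over both `b`
      -- and `r`. These points would then coincide although their colours differ.
      singleton : ∀ {z} → z ∈ N.point y → z ≡ y
      singleton {z} z∈ = decidable-stable (z Data.Fin.≟ y) absurd
        where
        absurd : z ≢ y → Absurd
        absurd z≢y = meets (zero ∈? ψ (embE m (N.point y)))
          where
          other : ∀ e → Dec (e ≡ y) → 1 ≤ rank N (N.point y - e)
          other e (yes refl) = N.1≤rank (x∈p∧x≢y⇒x∈p-y z∈ z≢y)
          other e (no e≢y)   = N.1≤rank (x∈p∧x≢y⇒x∈p-y (N.∈-point y) (e≢y ∘ sym))
          G-cf : IsCyclicFlat N (N.point y)
          G-cf = (λ e _ → ≤-antisym (rank-mono N _ _ (proj₁ ∘ ∈-remove⁻ {X = N.point y}))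
                            (≤-trans (≤-reflexive (N.rank-point y)) (other e (e Data.Fin.≟ y))))
               , N.point-flat y
          cG = N.embE-cf G-cf
          rank-1 : rank Q (ψ (embE m (N.point y))) ≡ 1
          rank-1 = trans (ψ-rank cG) (trans (proj₁ (proj₂ cN) _ G-cf) (N.rank-point y))
          isB-⊆ : embE m (N.point y) ⊆ image b
          isB-⊆ {z} p = subst (z ∈_) (sym (blue-image b isB)) (embE⊆qSet {N.point y} (λ {x} q → subst (x ∈_) (sym G≡) q) p)
          isR-⊆ : embE m (N.point y) ⊆ image r
          isR-⊆ {z} p = subst (z ∈_) (sym (red-image r isR))
            (embE⊆ {N.point y} (λ {x} q → ∈-embE⁺ (blue⊆red b r isB isR (subst (x ∈_) (sym G≡) q))) p)
          with-tip : (∃ λ F → IsFlat M F × (∃ λ e → e ∈ F) × ψ (embE m (N.point y)) ≡ qSet m F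
                            × rank Q (ψ (embE m (N.point y))) ≡ suc (rank M F)) → Absurd
          with-tip (F , _ , (e , e∈) , _ , rF) = <-irrefl (trans (sym rank-1) rF) (s≤s (M.1≤rank e∈))
          without-tip : (∃ λ P → IsCyclicFlat M P × ψ (embE m (N.point y)) ≡ embE m P
                               × rank Q (ψ (embE m (N.point y))) ≡ rank M P) → Absurd
          without-tip (P , _ , eq , rP) = isR (subst (zero ∈_) (image-cong b r
            (trans (M.point-≡ (in-point b isB-⊆)) (sym (M.point-≡ (in-point r isR-⊆))))) isB)
            where
            nonempty = M.nonempty-of-rank {P} (≤-reflexive (trans (sym rank-1) rP))
            in-point : ∀ f → embE m (N.point y) ⊆ image f → proj₁ nonempty ∈ M.point f
            in-point f sub = embE⊆qSet⁻ {P} {M.point f}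
              (λ {z} p → subst (z ∈_) (ψ-image f) (ψ-mono cG (image-cf f) sub (subst (z ∈_) (sym eq) p))) (proj₂ nonempty)
          meets : Dec (zero ∈ ψ (embE m (N.point y))) → Absurd
          meets (yes tip∈) = with-tip (M.cf-with-tip (ψ-cf cG) tip∈)
          meets (no tip∉)  = without-tip (M.cf-without-tip (ψ-cf cG) tip∉)

      -- Dropping `y` from the red shadows makes them disjoint from G and from each other. As a
      -- function of the image, the block depends only on the point.
      block : Subset (suc (n + n * m)) → Subset n
      block Y = if does (zero ∈? Y) then trace Y else (trace Y - y)

      block-blue : ∀ e → Blue e → block (image e) ≡ shadow e
      block-blue e isE = cong (λ b → if b then shadow e else (shadow e - y)) (dec-true (zero ∈? image e) isE)

      block-red : ∀ e → Red e → block (image e) ≡ shadow e - y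
      block-red e isE = cong (λ b → if b then shadow e else (shadow e - y)) (dec-false (zero ∈? image e) isE)

      block-blue⁻ : ∀ e {z} → Blue e → z ∈ block (image e) → z ≡ y
      block-blue⁻ e {z} isE z∈ = singleton (subst (z ∈_) (trans (block-blue e isE)
        (trans (cong trace (image-cong e b (only e isE))) G≡)) z∈)

      block-red⁻ : ∀ e {z} → Red e → z ∈ block (image e) → z ∈ shadow e × z ≢ y
      block-red⁻ e {z} isE z∈ = ∈-remove⁻ {X = shadow e} (subst (z ∈_) (block-red e isE) z∈)

      meet : ∀ x x′ {z} → z ∈ block (image x) → z ∈ block (image x′) → M.point x ≡ M.point x′
      meet x x′ {z} z∈ z∈′ = go (zero ∈? image x) (zero ∈? image x′)
        where
        go : Dec (Blue x) → Dec (Blue x′) → M.point x ≡ M.point x′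
        go (yes bx) (yes bx′) = trans (only x bx) (sym (only x′ bx′))
        go (yes bx) (no rx′)  = ⊥-elim (proj₂ (block-red⁻ x′ rx′ z∈′) (block-blue⁻ x bx z∈))
        go (no rx)  (yes bx′) = ⊥-elim (proj₂ (block-red⁻ x rx z∈) (block-blue⁻ x′ bx′ z∈′))
        go (no rx)  (no rx′)  = shadow-red-injective x x′ rx rx′ (red-line-unique x x′ rx rx′
          (blue⊆red b x isB rx y∈) (proj₁ (block-red⁻ x rx z∈)) (blue⊆red b x′ isB rx′ y∈) (proj₁ (block-red⁻ x′ rx′ z∈′))
          (proj₂ (block-red⁻ x rx z∈) ∘ singleton))

      -- Removing `y` cancels the 1 in |Z| = 1 + (m+1)|F|. What is left exceeds |F| because F is
      -- nonempty and m ≥ 1.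
      size-red : ∀ e → Red e → ∣ M.point e ∣ < ∣ block (image e) ∣
      size-red e isE = begin-strict
        ∣ M.point e ∣                          <⟨ m<m+n ∣ M.point e ∣ (*-mono-≤ 1≤size 1≤m) ⟩
        ∣ M.point e ∣ + ∣ M.point e ∣ * m      ≡⟨ suc-injective (trans (sym (∣qSet∣ (M.point e)))
                                                   (trans (sym (RedShadow.size (red e isE))) (∣remove∣ (blue⊆red b e isB isE y∈)))) ⟩
        ∣ shadow e - y ∣                       ≡⟨ cong ∣_∣ (sym (block-red e isE)) ⟩
        ∣ block (image e) ∣                    ∎
        where
        open ≤-Reasoning
        1≤size : 1 ≤ ∣ M.point e ∣
        1≤size = ≤-trans (≤-reflexive (sym (∣⁅x⁆∣≡1 e))) (p⊆q⇒∣p∣≤∣q∣ (⁅⁆⊆ (M.∈-point e)))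

      size : ∀ e → ∣ M.point e ∣ ≤ ∣ block (image e) ∣
      size e = go (zero ∈? image e)
        where
        go : Dec (Blue e) → ∣ M.point e ∣ ≤ ∣ block (image e) ∣
        go (yes isE) = ≤-reflexive (trans (sym (BlueShadow.size (blue e isE))) (cong ∣_∣ (sym (block-blue e isE))))
        go (no isE)  = <⇒≤ (size-red e isE)

      open Glue M.point (block ∘ image) M.∈-point meet (λ x x′ eq → cong block (image-cong x x′ eq)) size

      missed = glue-misses r (size-red r isR)

  -- Using the correspondence in both directions

  module _ (M N : Matroid n) (lM : Loopless M) (lN : Loopless N)
    (Q Q′ : Matroid (suc (n + n * m))) (cM : IsFreeCone M m Q) (cN : IsFreeCone N m Q′)
    (C : Correspondence Q Q′) where

    open Correspondence C
    private
      module Fwd = Compare M N lM lN Q Q′ cM cN C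
      module Bwd = Compare N M lN lM Q′ Q cN cM (flip C)
      module M where
        open Points M lM public
        open ConeFlats M lM Q cM public
      module N where
        open Points N lN public
        open ConeFlats N lN Q′ cN public

      -- Blue points are matched both ways: for any `y` in the shadow G of `b`, the cone over `y` is
      -- q(G), which ψ sends back to the cone over `b`.
      blue-transfer : ∀ b (isB : Fwd.Blue b) → ∃ λ y → y ∈ Fwd.shadow b × Bwd.image y ≡ M.cone-point b
      blue-transfer b isB = y , y∈ , trans
        (cong ψ (trans (cong (qSet m) (sym (Fwd.shadow-blue b isB y∈))) (sym (Fwd.blue-image b isB)))) (Fwd.ψ-image b)
        where
        y = proj₁ (Fwd.shadow-blue-nonempty b isB)
        y∈ = proj₂ (Fwd.shadow-blue-nonempty b isB)

    -- In rank two the whole line of M may be exchanged with a red point. The red classes on both sides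
    -- then have the same size, and matching them repairs the bijection between points.
    module Swap (r b b′ y₀ : Fin n) (isR : Fwd.Red r) (isB : Fwd.Blue b) (isB′ : Fwd.Blue b′)
      (b≢b′ : M.point b ≢ M.point b′) (y₀-red : Bwd.Red y₀) where

      private
        module TF = Fwd.TwoBlue r b b′ isR isB isB′ b≢b′

        c  = proj₁ (blue-transfer b isB)
        c′ = proj₁ (blue-transfer b′ isB′)

        c-blue : Bwd.Blue c
        c-blue = subst (zero ∈_) (sym (proj₂ (proj₂ (blue-transfer b isB)))) (tip∈qSet {M.point b})

        c′-blue : Bwd.Blue c′
        c′-blue = subst (zero ∈_) (sym (proj₂ (proj₂ (blue-transfer b′ isB′)))) (tip∈qSet {M.point b′})

        c≢c′ : N.point c ≢ N.point c′
        c≢c′ eq = b≢b′ (M.cone-point-injective b b′ (trans (sym (proj₂ (proj₂ (blue-transfer b isB))))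
          (trans (Bwd.image-cong c c′ eq) (proj₂ (proj₂ (blue-transfer b′ isB′))))))

        module TB = Bwd.TwoBlue y₀ c c′ y₀-red c-blue c′-blue c≢c′

        -- By `TwoBlue` on either side, both red images are the embedded ground set, so the cones
        -- over the two red points have equal size.
        red-size : ∣ M.point r ∣ ≡ ∣ N.point y₀ ∣
        red-size = ∣qSet∣-injective {M.point r} {N.point y₀} (begin
          ∣ M.cone-point r ∣  ≡⟨ sym (φ-size (M.cone-point-cf r)) ⟩
          ∣ Fwd.image r ∣       ≡⟨ cong ∣_∣ (trans TF.image-⊤ (sym TB.image-⊤)) ⟩
          ∣ Bwd.image y₀ ∣      ≡⟨ ψ-size (N.cone-point-cf y₀) ⟩
          ∣ N.cone-point y₀ ∣ ∎)
          where open ≡-Reasoning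

        block : Subset (suc (n + n * m)) → Subset n
        block Y = if does (zero ∈? Y) then trace Y else N.point y₀

        block-blue : ∀ e → Fwd.Blue e → block (Fwd.image e) ≡ Fwd.shadow e
        block-blue e isE = cong (λ b → if b then Fwd.shadow e else N.point y₀) (dec-true (zero ∈? Fwd.image e) isE)

        block-red : ∀ e → Fwd.Red e → block (Fwd.image e) ≡ N.point y₀
        block-red e isE = cong (λ b → if b then Fwd.shadow e else N.point y₀) (dec-false (zero ∈? Fwd.image e) isE)

        block-point : ∀ e {z} → z ∈ block (Fwd.image e) → block (Fwd.image e) ≡ N.point z
        block-point e {z} z∈ = go (zero ∈? Fwd.image e)
          where
          go : Dec (Fwd.Blue e) → block (Fwd.image e) ≡ N.point z
          go (yes isE) = trans (block-blue e isE) (Fwd.shadow-blue e isE (subst (z ∈_) (block-blue e isE) z∈))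
          go (no isE)  = trans (block-red e isE) (N.point-≡ (subst (z ∈_) (block-red e isE) z∈))

        -- Otherwise the point of `y₀` would be the shadow of `x`, and ψ would send its cone to the
        -- cone over `x`, making `y₀` blue.
        blue≢red : ∀ x {z} → Fwd.Blue x → z ∈ Fwd.shadow x → z ∉ N.point y₀
        blue≢red x isX z∈ z∈′ = y₀-red (subst (zero ∈_) (sym (trans (cong ψ (sym image≡)) (Fwd.ψ-image x))) (tip∈qSet {M.point x}))
          where
          image≡ : Fwd.image x ≡ N.cone-point y₀
          image≡ = trans (Fwd.blue-image x isX)
            (cong (qSet m) (trans (Fwd.shadow-blue x isX z∈) (sym (N.point-≡ z∈′))))

        meet : ∀ x x′ {z} → z ∈ block (Fwd.image x) → z ∈ block (Fwd.image x′) → M.point x ≡ M.point x′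
        meet x x′ {z} z∈ z∈′ = go (zero ∈? Fwd.image x) (zero ∈? Fwd.image x′)
          where
          in-blue : ∀ {e} → z ∈ block (Fwd.image e) → Fwd.Blue e → z ∈ Fwd.shadow e
          in-blue {e} p isE = subst (z ∈_) (block-blue e isE) p
          in-red : ∀ {e} → z ∈ block (Fwd.image e) → Fwd.Red e → z ∈ N.point y₀
          in-red {e} p isE = subst (z ∈_) (block-red e isE) p
          go : Dec (Fwd.Blue x) → Dec (Fwd.Blue x′) → M.point x ≡ M.point x′
          go (yes bx) (yes bx′) = Fwd.shadow-blue-injective x x′ bx bx′
            (trans (Fwd.shadow-blue x bx (in-blue {x} z∈ bx)) (sym (Fwd.shadow-blue x′ bx′ (in-blue {x′} z∈′ bx′))))
          go (yes bx) (no rx′)  = ⊥-elim (blue≢red x bx (in-blue {x} z∈ bx) (in-red {x′} z∈′ rx′))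
          go (no rx)  (yes bx′) = ⊥-elim (blue≢red x′ bx′ (in-blue {x′} z∈′ bx′) (in-red {x} z∈ rx))
          go (no rx)  (no rx′)  = trans (TF.red-unique x rx) (sym (TF.red-unique x′ rx′))

        size : ∀ e → ∣ M.point e ∣ ≤ ∣ block (Fwd.image e) ∣
        size e = ≤-reflexive (go (zero ∈? Fwd.image e))
          where
          go : Dec (Fwd.Blue e) → ∣ M.point e ∣ ≡ ∣ block (Fwd.image e) ∣
          go (yes isE) = trans (sym (Fwd.BlueShadow.size (Fwd.blue e isE))) (cong ∣_∣ (sym (block-blue e isE)))
          go (no isE)  = trans (cong ∣_∣ (TF.red-unique e isE)) (trans red-size (cong ∣_∣ (sym (block-red e isE))))

        open Glue M.point (block ∘ Fwd.image) M.∈-point meet (λ x x′ eq → cong block (Fwd.image-cong x x′ eq)) size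

      isomorphic : Isomorphic M N
      -- `TB` works with the roles of `M` and `N` exchanged, so its `rank-N-⊤` is the rank of `M`.
      isomorphic = rank-2-isomorphic M N lM lN (≤-reflexive TB.rank-N-⊤) (≤-reflexive TF.rank-N-⊤) glue glue-injective
        (λ {x} {x′} eq → trans (sym (block-point x (glue-∈ x)))
          (trans (cong block (Fwd.image-cong x x′ eq)) (block-point x′ (glue-∈ x′))))
        (λ {x} {x′} eq → meet x x′ (glue-∈ x)
          (subst (glue x ∈_) (trans eq (sym (block-point x′ (glue-∈ x′)))) (N.∈-point (glue x))))

    -- If either side has no red point, `AllBlue` applies in that direction. Otherwise both sides
    -- have one, as `Swap` requires, and the number of blue points of `M` decides.
    correspondence⇒isomorphic : Isomorphic M N
    correspondence⇒isomorphic = redM? (any? (λ e → ¬? (zero ∈? Fwd.image e)))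
      where
      secondBlue? : ∀ {r y₀ b} → Fwd.Red r → Bwd.Red y₀ → Fwd.Blue b →
                    Dec (∃ λ e → Fwd.Blue e × e ∉ M.point b) → Isomorphic M N
      secondBlue? {r} {y₀} {b} isR y₀-red isB (yes (b′ , isB′ , b′∉)) =
        Swap.isomorphic r b b′ y₀ isR isB isB′ (λ eq → b′∉ (subst (b′ ∈_) (sym eq) (M.∈-point b′))) y₀-red
      secondBlue? {r} {y₀} {b} isR _ isB (no none) = ⊥-elim (Fwd.oneBlue-absurd r b isR isB (λ e isE →
        sym (M.point-≡ (decidable-stable (e ∈? M.point b) (λ e∉ → none (e , isE , e∉))))))
      blue? : ∀ {r y₀} → Fwd.Red r → Bwd.Red y₀ → Dec (∃ Fwd.Blue) → Isomorphic M N
      blue? {r} _ _ (no noBlue) = ⊥-elim (Fwd.allRed-absurd (λ e isE → noBlue (e , isE)) r)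
      blue? {r} {y₀} isR y₀-red (yes (b , isB)) = secondBlue? {r} {y₀} {b} isR y₀-red isB
        (any? (λ e → (zero ∈? Fwd.image e) ×-dec ¬? (e ∈? M.point b)))
      redN? : ∀ {r} → Fwd.Red r → Dec (∃ Bwd.Red) → Isomorphic M N
      redN? _ (no noRed) = isomorphic-sym N M
        (Bwd.AllBlue.isomorphic (λ y → decidable-stable (zero ∈? Bwd.image y) (λ isY → noRed (y , isY))))
      redN? {r} isR (yes (y₀ , y₀-red)) = blue? {r} {y₀} isR y₀-red (any? (λ e → zero ∈? Fwd.image e))
      redM? : Dec (∃ Fwd.Red) → Isomorphic M N
      redM? (no noRed) = Fwd.AllBlue.isomorphic (λ e → decidable-stable (zero ∈? Fwd.image e) (λ isE → noRed (e , isE)))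
      redM? (yes (r , isR)) = redN? {r} isR (any? (λ y → ¬? (zero ∈? Bwd.image y)))

theorem3p2 : ∀ {n n' : ℕ} (M : Matroid n) (N : Matroid n') →
    Loopless M → Loopless N → ¬ Isomorphic M N → SameG M N →
    ∀ (m : ℕ) → 1 ≤ m →
    ∀ (Q : Matroid (suc (n + n * m))) (Q' : Matroid (suc (n' + n' * m))) →
    IsFreeCone M m Q → IsFreeCone N m Q' →
    SameG Q Q' × ¬ SameConfig Q Q'
theorem3p2 M N lM lN M≇N same m 1≤m Q Q' cM cN with sameG⇒≡ M N same
-- Equal G-invariants force ground sets of equal size, so both matroids may be taken on the same
-- set.
... | refl = sameG-cone m M N same Q Q' cM cN
           , λ config → M≇N (correspondence⇒isomorphic 1≤m M N lM lN Q Q' cM cN (correspondence config))
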